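{- Let $\mathcal{C}$ be an $I$-cellular CwF, $\Gamma$ an object and $\Delta$ a telescope over $\Gamma$. Let $x_1,x_2$ be parallel elements over $\Gamma.\Delta$ of one of the following kinds: (i) $x_1,x_2\in\mathsf{Tm}^{\star}(\Gamma.\Delta,\Xi)$ for a telescope $\Xi$ over $\Gamma.\Delta$; (ii) $x_1,x_2\in\mathsf{Ty}(\Gamma.\Delta)$; (iii) $x_1,x_2\in\mathsf{Tm}(\Gamma.\Delta,A)$ for some $A\in\mathsf{Ty}(\Gamma.\Delta)$. If there exists a unifier $\sigma:\Theta\to\Gamma$ of $x_1$ and $x_2$, then there exists a most general unifier $\rho:\Omega\to\Gamma$ of $x_1$ and $x_2$ such that either $\rho=\mathrm{id}_\Gamma$ or the length of $\Omega$ is strictly less than the length of $\Gamma$.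
   Context: A CwF consists of a category with terminal object $\diamond$, a presheaf $\mathsf{Ty}$ of types, sets $\mathsf{Tm}(\Gamma,A)$ of terms with functorial substitution, and context extensions $\Gamma.A$ with $\mathbf{p}_A$, $\mathbf{q}_A$ representing pairs of a substitution and a term. A telescope over $\Gamma$ is a finite sequence $A_1\in\mathsf{Ty}(\Gamma)$, $A_2\in\mathsf{Ty}(\Gamma.A_1)$, \dots; $\Gamma.\Delta$ is the iterated extension; for a telescope $\Xi=(B_1,\dots,B_m)$ over $\Gamma.\Delta$, $\mathsf{Tm}^{\star}(\Gamma.\Delta,\Xi)$ is the set of tuples $(b_1,\dots,b_m)$ with $b_1\in\mathsf{Tm}(\Gamma.\Delta,B_1)$, $b_2\in\mathsf{Tm}(\Gamma.\Delta,B_2[\langle\mathrm{id},b_1\rangle])$, etc. For $\rho:\Theta\to\Gamma$, $\rho^+:\Theta.\Delta[\rho]\to\Gamma.\Delta$ is the induced map acting as identity on the variables of $\Delta$. $I$-cellular CwF: built from the initial CwF by a countable sequence of pushouts of coproducts of the maps $I^{\mathsf{ty}}$ (freely adjoining a new type over an existing object) and $I^{\mathsf{tm}}$ (freely adjoining a new term of an existing type), i.e. freely generated by generating types and terms with no equations. It is contextual: each object is $\diamond.A_1.\cdots.A_n$ for a unique closed telescope, and $n$ is its length. A unifier of parallel $x_1,x_2$ over $\Gamma.\Delta$ is a morphism $\rho:\Theta\to\Gamma$ with $x_1[\rho^+]=x_2[\rho^+]$. A most general unifier is a terminal unifier: a unifier $\rho_0$ through which every unifier $\rho$ factors uniquely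 as $\rho=\rho_0\circ\tau$. -}

module Defs where

open import Data.Nat using (ℕ; zero; suc; _<_)
open import Data.Product using (Σ; _×_; _,_)
open import Data.Unit using (⊤; tt)
open import Relation.Binary.PropositionalEquality using (_≡_; refl; sym; subst)
open import Relation.Binary.HeterogeneousEquality using (_≅_)

record CwF : Set₁ where
  infixl 9 _∘_
  infixl 8 _[_]T _[_]t
  infixl 5 _▹_
  field
    Ob  : Set
    Hom : Ob → Ob → Set
    id  : ∀ {Γ} → Hom Γ Γ
    _∘_ : ∀ {Γ Δ Θ} → Hom Δ Γ → Hom Θ Δ → Hom Θ Γ
    idl : ∀ {Γ Δ} (σ : Hom Δ Γ) → id ∘ σ ≡ σ
    idr : ∀ {Γ Δ} (σ : Hom Δ Γ) → σ ∘ id ≡ σ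
    ass : ∀ {Γ Δ Θ Ψ} (σ : Hom Δ Γ) (τ : Hom Θ Δ) (υ : Hom Ψ Θ) →
          (σ ∘ τ) ∘ υ ≡ σ ∘ (τ ∘ υ)
    ◇   : Ob
    ε   : ∀ {Γ} → Hom Γ ◇
    ε-η : ∀ {Γ} (σ : Hom Γ ◇) → σ ≡ ε
    Ty    : Ob → Set
    _[_]T : ∀ {Γ Δ} → Ty Γ → Hom Δ Γ → Ty Δ
    [id]T : ∀ {Γ} (A : Ty Γ) → A [ id ]T ≡ A
    [∘]T  : ∀ {Γ Δ Θ} (A : Ty Γ) (σ : Hom Δ Γ) (τ : Hom Θ Δ) →
            A [ σ ∘ τ ]T ≡ A [ σ ]T [ τ ]T
    Tm    : (Γ : Ob) → Ty Γ → Set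
    _[_]t : ∀ {Γ Δ} {A : Ty Γ} → Tm Γ A → (σ : Hom Δ Γ) → Tm Δ (A [ σ ]T)
    [id]t : ∀ {Γ} {A : Ty Γ} (t : Tm Γ A) → t [ id ]t ≅ t
    [∘]t  : ∀ {Γ Δ Θ} {A : Ty Γ} (t : Tm Γ A) (σ : Hom Δ Γ) (τ : Hom Θ Δ) →
            t [ σ ∘ τ ]t ≅ t [ σ ]t [ τ ]t
    _▹_   : (Γ : Ob) → Ty Γ → Ob
    p     : ∀ {Γ} {A : Ty Γ} → Hom (Γ ▹ A) Γ
    q     : ∀ {Γ} {A : Ty Γ} → Tm (Γ ▹ A) (A [ p ]T)
    ⟨_,_⟩ : ∀ {Γ Δ} {A : Ty Γ} (σ : Hom Δ Γ) → Tm Δ (A [ σ ]T) → Hom Δ (Γ ▹ A)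
    p∘⟨⟩  : ∀ {Γ Δ} {A : Ty Γ} (σ : Hom Δ Γ) (t : Tm Δ (A [ σ ]T)) →
            p ∘ ⟨ σ , t ⟩ ≡ σ
    q[⟨⟩] : ∀ {Γ Δ} {A : Ty Γ} (σ : Hom Δ Γ) (t : Tm Δ (A [ σ ]T)) →
            q [ ⟨ σ , t ⟩ ]t ≅ t
    ⟨⟩-η  : ∀ {Γ Δ} {A : Ty Γ} (τ τ' : Hom Δ (Γ ▹ A)) →
            p ∘ τ ≡ p ∘ τ' → q [ τ ]t ≅ q [ τ' ]t → τ ≡ τ'
    ⟨⟩∘   : ∀ {Γ Δ Θ} {A : Ty Γ} (σ : Hom Δ Γ) (t : Tm Δ (A [ σ ]T)) (τ : Hom Θ Δ) →
            ⟨ σ , t ⟩ ∘ τ ≡ ⟨ σ ∘ τ , subst (Tm Θ) (sym ([∘]T A σ τ)) (t [ τ ]t) ⟩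

record Mor (C D : CwF) : Set where
  private
    module C = CwF C
    module D = CwF D
  field
    ob    : C.Ob → D.Ob
    hom   : ∀ {Γ Δ} → C.Hom Δ Γ → D.Hom (ob Δ) (ob Γ)
    hom-id : ∀ {Γ} → hom (C.id {Γ}) ≡ D.id
    hom-∘ : ∀ {Γ Δ Θ} (σ : C.Hom Δ Γ) (τ : C.Hom Θ Δ) →
            hom (σ C.∘ τ) ≡ hom σ D.∘ hom τ
    ob-◇  : ob C.◇ ≡ D.◇
    ty    : ∀ {Γ} → C.Ty Γ → D.Ty (ob Γ)
    ty-sub : ∀ {Γ Δ} (A : C.Ty Γ) (σ : C.Hom Δ Γ) →
             ty (A C.[ σ ]T) ≡ ty A D.[ hom σ ]T
    tm    : ∀ {Γ} {A : C.Ty Γ} → C.Tm Γ A → D.Tm (ob Γ) (ty A)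
    tm-sub : ∀ {Γ Δ} {A : C.Ty Γ} (t : C.Tm Γ A) (σ : C.Hom Δ Γ) →
             tm (t C.[ σ ]t) ≅ tm t D.[ hom σ ]t
    ob-▹  : ∀ {Γ} (A : C.Ty Γ) → ob (Γ C.▹ A) ≡ ob Γ D.▹ ty A
    hom-p : ∀ {Γ} (A : C.Ty Γ) → hom (C.p {Γ} {A}) ≅ D.p {ob Γ} {ty A}
    tm-q  : ∀ {Γ} (A : C.Ty Γ) → tm (C.q {Γ} {A}) ≅ D.q {ob Γ} {ty A}

record _≐_ {C D : CwF} (F G : Mor C D) : Set where
  private
    module C = CwF C
    module F = Mor F
    module G = Mor G
  field
    ob≐  : ∀ Γ → F.ob Γ ≡ G.ob Γ
    hom≐ : ∀ {Γ Δ} (σ : C.Hom Δ Γ) → F.hom σ ≅ G.hom σ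
    ty≐  : ∀ {Γ} (A : C.Ty Γ) → F.ty A ≅ G.ty A
    tm≐  : ∀ {Γ} {A : C.Ty Γ} (t : C.Tm Γ A) → F.tm t ≅ G.tm t

record Comp≐ {C D E : CwF} (H : Mor D E) (F : Mor C D) (G : Mor C E) : Set where
  private
    module C = CwF C
    module H = Mor H
    module F = Mor F
    module G = Mor G
  field
    ob≐  : ∀ Γ → H.ob (F.ob Γ) ≡ G.ob Γ
    hom≐ : ∀ {Γ Δ} (σ : C.Hom Δ Γ) → H.hom (F.hom σ) ≅ G.hom σ
    ty≐  : ∀ {Γ} (A : C.Ty Γ) → H.ty (F.ty A) ≅ G.ty A
    tm≐  : ∀ {Γ} {A : C.Ty Γ} (t : C.Tm Γ A) → H.tm (F.tm t) ≅ G.tm t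

IsInitial : CwF → Set₁
IsInitial C = (E : CwF) → Σ (Mor C E) λ F → (G : Mor C E) → G ≐ F

-- Pushouts of coproducts of I^ty and I^tm.
-- A map  F(Γ:Ob) → C  is an object of C and a map  F(Γ:Ob, A:Ty Γ) → C  is
-- a pair (Γ, A); so a family of attaching maps is a family of cells:

data Cell (C : CwF) : Set where
  tyCell : (Γ : CwF.Ob C) → Cell C
  tmCell : (Γ : CwF.Ob C) (A : CwF.Ty C Γ) → Cell C

-- the data of an extension of the attaching map along the cell  (along F : C → D)
Fill : {C D : CwF} → Mor C D → Cell C → Set
Fill {D = D} F (tyCell Γ)   = CwF.Ty D (Mor.ob F Γ)
Fill {D = D} F (tmCell Γ A) = CwF.Tm D (Mor.ob F Γ) (Mor.ty F A)

FillRel : {C D E : CwF} (H : Mor D E) (F : Mor C D) (G : Mor C E) (c : Cell C) →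
          Fill F c → Fill G c → Set
FillRel H F G (tyCell Γ)   x y = Mor.ty H x ≅ y
FillRel H F G (tmCell Γ A) x y = Mor.tm H x ≅ y

IsCellPushout : {C D : CwF} → Mor C D → Set₁
IsCellPushout {C} {D} F =
  Σ Set λ J → Σ (J → Cell C) λ cell → Σ ((j : J) → Fill F (cell j)) λ gen →
    (E : CwF) (G : Mor C E) (g : (j : J) → Fill G (cell j)) →
    Σ (Mor D E) λ H →
      (Comp≐ H F G × ((j : J) → FillRel H F G (cell j) (gen j) (g j))) ×
      ((H' : Mor D E) → Comp≐ H' F G →
         ((j : J) → FillRel H' F G (cell j) (gen j) (g j)) → H' ≐ H)

IsSeqColimit : (Cs : ℕ → CwF) (fs : (n : ℕ) → Mor (Cs n) (Cs (suc n)))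
               (C : CwF) (ι : (n : ℕ) → Mor (Cs n) C) → Set₁
IsSeqColimit Cs fs C ι =
  ((n : ℕ) → Comp≐ (ι (suc n)) (fs n) (ι n)) ×
  ((E : CwF) (g : (n : ℕ) → Mor (Cs n) E) →
     ((n : ℕ) → Comp≐ (g (suc n)) (fs n) (g n)) →
     Σ (Mor C E) λ H → ((n : ℕ) → Comp≐ H (ι n) (g n)) ×
       ((H' : Mor C E) → ((n : ℕ) → Comp≐ H' (ι n) (g n)) → H' ≐ H))

IsICellular : CwF → Set₁
IsICellular C =
  Σ (ℕ → CwF) λ Cs → Σ ((n : ℕ) → Mor (Cs n) (Cs (suc n))) λ fs →
  Σ ((n : ℕ) → Mor (Cs n) C) λ ι →
    IsInitial (Cs 0) × ((n : ℕ) → IsCellPushout (fs n)) × IsSeqColimit Cs fs C ι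

module _ (C : CwF) where
  open CwF C

  data Tele (Γ : Ob) : Set where
    []  : Tele Γ
    _∷_ : (A : Ty Γ) → Tele (Γ ▹ A) → Tele Γ

  _⊳_ : (Γ : Ob) → Tele Γ → Ob
  Γ ⊳ []      = Γ
  Γ ⊳ (A ∷ Δ) = (Γ ▹ A) ⊳ Δ

  tlen : ∀ {Γ} → Tele Γ → ℕ
  tlen []      = 0
  tlen (A ∷ Δ) = suc (tlen Δ)

  lift : ∀ {Γ Θ} (ρ : Hom Θ Γ) (A : Ty Γ) → Hom (Θ ▹ A [ ρ ]T) (Γ ▹ A)
  lift ρ A = ⟨ ρ ∘ p , subst (Tm _) (sym ([∘]T A ρ p)) q ⟩

  _[_]Tel : ∀ {Γ Θ} → Tele Γ → Hom Θ Γ → Tele Θ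
  []      [ ρ ]Tel = []
  (A ∷ Δ) [ ρ ]Tel = (A [ ρ ]T) ∷ (Δ [ lift ρ A ]Tel)

  _⁺ : ∀ {Γ Θ} (ρ : Hom Θ Γ) {Δ : Tele Γ} → Hom (Θ ⊳ (Δ [ ρ ]Tel)) (Γ ⊳ Δ)
  (ρ ⁺) {[]}    = ρ
  (ρ ⁺) {A ∷ Δ} = (lift ρ A ⁺) {Δ}

  TmS : (Ψ : Ob) {Φ : Ob} → Hom Ψ Φ → Tele Φ → Set
  TmS Ψ σ []      = ⊤
  TmS Ψ σ (B ∷ Ξ) = Σ (Tm Ψ (B [ σ ]T)) λ b → TmS Ψ ⟨ σ , b ⟩ Ξ

  Tm⋆ : (Ψ : Ob) → Tele Ψ → Set
  Tm⋆ Ψ Ξ = TmS Ψ id Ξ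

  subS : ∀ {Ψ Ψ' Φ} {σ : Hom Ψ Φ} (Ξ : Tele Φ) → TmS Ψ σ Ξ → (τ : Hom Ψ' Ψ) →
         TmS Ψ' (σ ∘ τ) Ξ
  subS []      tt       τ = tt
  subS {Ψ' = Ψ'} {σ = σ} (B ∷ Ξ) (b , bs) τ =
    subst (Tm Ψ') (sym ([∘]T B σ τ)) (b [ τ ]t) ,
    subst (λ s → TmS Ψ' s Ξ) (⟨⟩∘ σ b τ) (subS Ξ bs τ)

  data Parallel (Ψ : Ob) : Set where
    tm⋆-pair : (Ξ : Tele Ψ) → Tm⋆ Ψ Ξ → Tm⋆ Ψ Ξ → Parallel Ψ
    ty-pair  : Ty Ψ → Ty Ψ → Parallel Ψ
    tm-pair  : (A : Ty Ψ) → Tm Ψ A → Tm Ψ A → Parallel Ψ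

  EqualizedBy : ∀ {Ψ Ψ'} → Parallel Ψ → Hom Ψ' Ψ → Set
  EqualizedBy (tm⋆-pair Ξ x₁ x₂) τ = subS Ξ x₁ τ ≡ subS Ξ x₂ τ
  EqualizedBy (ty-pair A₁ A₂)    τ = A₁ [ τ ]T ≡ A₂ [ τ ]T
  EqualizedBy (tm-pair A x₁ x₂)  τ = x₁ [ τ ]t ≡ x₂ [ τ ]t

  IsUnifier : ∀ {Γ Θ} (Δ : Tele Γ) → Parallel (Γ ⊳ Δ) → Hom Θ Γ → Set
  IsUnifier Δ x ρ = EqualizedBy x ((ρ ⁺) {Δ})

  IsMGU : ∀ {Γ Ω} (Δ : Tele Γ) → Parallel (Γ ⊳ Δ) → Hom Ω Γ → Set
  IsMGU {Γ} {Ω} Δ x ρ₀ =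
    IsUnifier Δ x ρ₀ ×
    (∀ {Θ} (ρ : Hom Θ Γ) → IsUnifier Δ x ρ →
       Σ (Hom Θ Ω) λ τ → (ρ ≡ ρ₀ ∘ τ) × ((τ' : Hom Θ Ω) → ρ ≡ ρ₀ ∘ τ' → τ' ≡ τ))

  HasLength : Ob → ℕ → Set
  HasLength Γ n = Σ (Tele ◇) λ Δ → (◇ ⊳ Δ ≡ Γ) × (tlen Δ ≡ n)

{-# OPTIONS --safe #-}
-- The universal property of the cellular construction gives an induction principle for C.  It shows
-- that C is isomorphic to a CwF of well-typed raw syntax, in which a type is a generator applied to a
-- substitution and a term is either a variable or a generator applied to a substitution, so that
-- first-order unification applies.  Heads of unifiable expressions agree, which reduces everything
-- to equations x = t with x a variable of Γ: by unifiability t mentions neither variables of Δ nor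
-- x properly.  Then t does not depend on x even through the types of its variables, so t lives in
-- the part I of Γ independent of x, and the most general unifier is the pullback of
-- (id , t) : I → I.A along Γ → I.A, where x : A.  It exists, and is one variable shorter than Γ,
-- because the variables of Γ depending on x form a telescope over I.A.
module Submission where

open import Defs
open import Data.Nat using (ℕ; zero; suc; _+_; _<_; _≤_; s≤s)
open import Data.Nat.Properties using (≤-trans; ≤-refl; ≤-reflexive; <-trans; <-irrefl; m≤m+n; m≤n+m; +-suc; +-identityʳ; <⇒≤)
open import Data.Fin using (Fin; zero; suc)
open import Data.Fin.Properties using (_≟_; suc-injective)
open import Data.Product using (Σ; _×_; _,_; proj₁; proj₂)
open import Data.Sum using (_⊎_; inj₁; inj₂)
open import Data.Unit using (⊤; tt)
open import Data.Empty using (⊥; ⊥-elim)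
open import Function using (case_of_)
open import Relation.Nullary using (¬_; yes; no)
open import Relation.Binary.PropositionalEquality using (_≡_; refl; sym; trans; cong; cong₂; subst; subst₂)
open import Relation.Binary.HeterogeneousEquality as Het using (_≅_; refl; ≅-to-≡; ≡-to-≅; ≡-subst-removable)

-- The labels of generators come from arbitrary index sets without decidable equality, so a clash of
-- heads cannot be tested. The given unifier takes the place of a failure branch: it supplies equal
-- heads and refutes a positive occurs check, and only equality of variables is ever decided. Each
-- recursive call therefore needs a unifier of its own subproblem, obtained by factoring the given
-- one through the partial solution. A partial solution may enlarge the expressions that remain, so
-- the recursion is lexicographic: the length of the context first, the syntax second. For this
-- reason a nontrivial solution must shorten the context, and the trivial one is kept apart as
-- syntactic equality. The obstacle in `x = t` is that `t` may use variables declared after `x`, so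
-- `x` cannot be instantiated in place: everything independent of `x` has to be moved before it. The
-- substitution `ρ⁺` fixes the variables of `Δ` while `Γ` and the types in `Δ` change; these
-- variables become rigid ones, counted by a number that stays the same throughout.

uip : ∀ {A : Set} {x y : A} (e e' : x ≡ y) → e ≡ e'
uip refl refl = refl

-- Types and terms share one syntax, in which tuples of expressions act as substitutions.  The
-- constant junk is never well typed: it only serves to make weakenings split monomorphisms.
module RawSyntax (G : Set) where
  infixl 5 _▸_
  infixl 9 _⊙_
  infixl 8 _[_]

  mutual
    data Raw (n : ℕ) : Set where
      var  : Fin n → Raw n
      gen  : G → ∀ {m} → Raws n m → Raw n
      junk : Raw n

    data Raws (n : ℕ) : ℕ → Set where
      []  : Raws n zero
      _▸_ : ∀ {m} → Raws n m → Raw n → Raws n (suc m)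

  -- Substitution calculus of raw expressions.

  lookup : ∀ {n m} → Raws n m → Fin m → Raw n
  lookup (rs ▸ r) zero    = r
  lookup (rs ▸ r) (suc i) = lookup rs i

  tabulate : ∀ {n m} → (Fin m → Raw n) → Raws n m
  tabulate {m = zero}  f = []
  tabulate {m = suc m} f = tabulate (λ i → f (suc i)) ▸ f zero

  mutual
    _[_] : ∀ {n m} → Raw m → Raws n m → Raw n
    var i    [ s ] = lookup s i
    gen g rs [ s ] = gen g (rs ⊙ s)
    junk     [ s ] = junk

    _⊙_ : ∀ {n m k} → Raws m k → Raws n m → Raws n k
    []       ⊙ s = []
    (rs ▸ r) ⊙ s = (rs ⊙ s) ▸ (r [ s ])

  ids : ∀ {n} → Raws n n
  ids = tabulate var

  wk : ∀ {n} → Raws (suc n) n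
  wk = tabulate (λ i → var (suc i))

  liftR : ∀ {n m} → Raws n m → Raws (suc n) (suc m)
  liftR s = (s ⊙ wk) ▸ var zero

  lookup-tabulate : ∀ {n m} (f : Fin m → Raw n) i → lookup (tabulate f) i ≡ f i
  lookup-tabulate f zero    = refl
  lookup-tabulate f (suc i) = lookup-tabulate (λ j → f (suc j)) i

  lookup-⊙ : ∀ {n m k} (rs : Raws m k) (s : Raws n m) i → lookup (rs ⊙ s) i ≡ lookup rs i [ s ]
  lookup-⊙ (rs ▸ r) s zero    = refl
  lookup-⊙ (rs ▸ r) s (suc i) = lookup-⊙ rs s i

  lookup-ext : ∀ {n m} (s t : Raws n m) → (∀ i → lookup s i ≡ lookup t i) → s ≡ t
  lookup-ext []      []      h = refl
  lookup-ext (s ▸ _) (t ▸ _) h = cong₂ _▸_ (lookup-ext s t (λ i → h (suc i))) (h zero)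

  mutual
    [ids] : ∀ {n} (r : Raw n) → r [ ids ] ≡ r
    [ids] (var i)    = lookup-tabulate var i
    [ids] (gen g rs) = cong (gen g) (⊙-ids rs)
    [ids] junk       = refl

    ⊙-ids : ∀ {n m} (rs : Raws n m) → rs ⊙ ids ≡ rs
    ⊙-ids []       = refl
    ⊙-ids (rs ▸ r) = cong₂ _▸_ (⊙-ids rs) ([ids] r)

  mutual
    [⊙] : ∀ {n m k} (r : Raw k) (s : Raws m k) (t : Raws n m) → r [ s ⊙ t ] ≡ r [ s ] [ t ]
    [⊙] (var i)    s t = lookup-⊙ s t i
    [⊙] (gen g rs) s t = cong (gen g) (sym (⊙-assoc rs s t))
    [⊙] junk       s t = refl

    ⊙-assoc : ∀ {n m k l} (rs : Raws k l) (s : Raws m k) (t : Raws n m) →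
              (rs ⊙ s) ⊙ t ≡ rs ⊙ (s ⊙ t)
    ⊙-assoc []       s t = refl
    ⊙-assoc (rs ▸ r) s t = cong₂ _▸_ (⊙-assoc rs s t) (sym ([⊙] r s t))

  ids-⊙ : ∀ {n m} (s : Raws n m) → ids ⊙ s ≡ s
  ids-⊙ s = lookup-ext _ _ λ i →
    trans (lookup-⊙ ids s i) (cong (_[ s ]) (lookup-tabulate var i))

  wk-⊙ : ∀ {n m} (s : Raws n m) (r : Raw n) → wk ⊙ (s ▸ r) ≡ s
  wk-⊙ s r = lookup-ext _ _ λ i →
    trans (lookup-⊙ wk (s ▸ r) i) (cong (_[ s ▸ r ]) (lookup-tabulate (λ j → var (suc j)) i))

  wk-⊙-▸ : ∀ {n m} (s : Raws n (suc m)) → (wk ⊙ s) ▸ lookup s zero ≡ s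
  wk-⊙-▸ (s ▸ r) = cong (_▸ r) (wk-⊙ s r)

  wk-⊙-liftR : ∀ {n m} (s : Raws n m) → wk ⊙ liftR s ≡ s ⊙ wk
  wk-⊙-liftR s = wk-⊙ (s ⊙ wk) (var zero)

  ⊙-wk-▸ : ∀ {n m k} (s : Raws m k) (t : Raws n m) (r : Raw n) → (s ⊙ wk) ⊙ (t ▸ r) ≡ s ⊙ t
  ⊙-wk-▸ s t r = trans (⊙-assoc s wk (t ▸ r)) (cong (s ⊙_) (wk-⊙ t r))

  liftR-⊙-▸ : ∀ {n m k} (s : Raws m k) (t : Raws n m) (r : Raw n) →
              liftR s ⊙ (t ▸ r) ≡ (s ⊙ t) ▸ r
  liftR-⊙-▸ s t r = cong (_▸ r) (⊙-wk-▸ s t r)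

  ▸-injective : ∀ {n m} {s t : Raws n m} {r u : Raw n} → s ▸ r ≡ t ▸ u → s ≡ t × r ≡ u
  ▸-injective refl = refl , refl

  liftR-⊙ : ∀ {n m k} (s : Raws m k) (t : Raws n m) → liftR s ⊙ liftR t ≡ liftR (s ⊙ t)
  liftR-⊙ s t = trans (liftR-⊙-▸ s (t ⊙ wk) (var zero)) (cong (_▸ var zero) (sym (⊙-assoc s t wk)))

  liftR-ids : ∀ {n} → liftR (ids {n}) ≡ ids
  liftR-ids = cong (_▸ var zero) (ids-⊙ wk)

-- Typed terms as pairs, contexts, and the partial interpretation of raw syntax.

module Pairing (C : CwF) where
  open CwF C

  -- A raw term determines its type along with its value, so interpretation lands in pairs.
  -- Equations between terms over different types become ordinary equalities.
  TTm : Ob → Set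
  TTm Γ = Σ (Ty Γ) (Tm Γ)

  infixl 8 _[_]p
  _[_]p : ∀ {Γ Δ} → TTm Γ → Hom Δ Γ → TTm Δ
  (A , t) [ σ ]p = A [ σ ]T , t [ σ ]t

  pair≡ : ∀ {Γ} {A B : Ty Γ} {t : Tm Γ A} {u : Tm Γ B} → A ≡ B → t ≅ u →
          _≡_ {A = TTm Γ} (A , t) (B , u)
  pair≡ refl refl = refl

  pair≅ : ∀ {Γ} {s s' : TTm Γ} → s ≡ s' → proj₂ s ≅ proj₂ s'
  pair≅ refl = refl

  [id]p : ∀ {Γ} (s : TTm Γ) → s [ id ]p ≡ s
  [id]p (A , t) = pair≡ ([id]T A) ([id]t t)

  [∘]p : ∀ {Γ Δ Θ} (s : TTm Γ) (σ : Hom Δ Γ) (τ : Hom Θ Δ) → s [ σ ∘ τ ]p ≡ s [ σ ]p [ τ ]p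
  [∘]p (A , t) σ τ = pair≡ ([∘]T A σ τ) ([∘]t t σ τ)

  qq : ∀ {Γ} (A : Ty Γ) → TTm (Γ ▹ A)
  qq A = A [ p ]T , q

  ext : ∀ {Γ Δ} {A : Ty Γ} (σ : Hom Δ Γ) (s : TTm Δ) → proj₁ s ≡ A [ σ ]T → Hom Δ (Γ ▹ A)
  ext σ (_ , t) refl = ⟨ σ , t ⟩

  p-ext : ∀ {Γ Δ} {A : Ty Γ} (σ : Hom Δ Γ) (s : TTm Δ) (e : proj₁ s ≡ A [ σ ]T) →
          p ∘ ext σ s e ≡ σ
  p-ext σ (_ , t) refl = p∘⟨⟩ σ t

  ext-≡ : ∀ {Γ Δ} {A : Ty Γ} (ρ ρ' : Hom Δ (Γ ▹ A)) → p ∘ ρ ≡ p ∘ ρ' →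
          qq A [ ρ ]p ≡ qq A [ ρ' ]p → ρ ≡ ρ'
  ext-≡ ρ ρ' e e' = ⟨⟩-η ρ ρ' e (pair≅ e')

  qq-ext : ∀ {Γ Δ} {A : Ty Γ} (σ : Hom Δ Γ) (s : TTm Δ) (e : proj₁ s ≡ A [ σ ]T) →
           qq A [ ext σ s e ]p ≡ s
  qq-ext {A = A} σ (_ , t) refl =
    pair≡ (trans (sym ([∘]T A p ⟨ σ , t ⟩)) (cong (A [_]T) (p∘⟨⟩ σ t))) (q[⟨⟩] σ t)

  ext-η : ∀ {Γ Δ} {A : Ty Γ} (ρ : Hom Δ (Γ ▹ A)) (σ : Hom Δ Γ) (s : TTm Δ)
          (e : proj₁ s ≡ A [ σ ]T) → σ ≡ p ∘ ρ → s ≡ qq A [ ρ ]p → ext σ s e ≡ ρ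
  ext-η ρ σ s e e₁ e₂ = ext-≡ _ _ (trans (p-ext σ s e) e₁) (trans (qq-ext σ s e) e₂)

  ε-η' : ∀ {Γ} (σ τ : Hom Γ ◇) → σ ≡ τ
  ε-η' σ τ = trans (ε-η σ) (sym (ε-η τ))

module Contexts (C : CwF) where
  open CwF C

  infixl 5 _▷_

  mutual
    -- The types in a context are types of `C`, not raw types. Contexts thus carry no typing proofs
    -- and make sense before any type of `C` is known to have a raw form.
    data Ctx : Set where
      ∙   : Ctx
      _▷_ : (γ : Ctx) → Ty ⟦ γ ⟧ → Ctx

    ⟦_⟧ : Ctx → Ob
    ⟦ ∙ ⟧     = ◇
    ⟦ γ ▷ A ⟧ = ⟦ γ ⟧ ▹ A

  len : Ctx → ℕ
  len ∙       = zero
  len (γ ▷ A) = suc (len γ)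

  data Gen : Set where
    tyGen : (δ : Ctx) → Ty ⟦ δ ⟧ → Gen
    tmGen : (δ : Ctx) (A : Ty ⟦ δ ⟧) → Tm ⟦ δ ⟧ A → Gen

-- Well-typedness of raw syntax is defined together with its interpretation in C, as a partial
-- interpretation function whose domain is a proposition: equality of well-typed expressions is
-- equality of raw expressions.
module Typing (C : CwF) (G : Set) (sig : G → Contexts.Gen C) where
  open CwF C
  open Pairing C public
  open Contexts C public
  open RawSyntax G public

  vars : ∀ γ → Fin (len γ) → TTm ⟦ γ ⟧
  vars (γ ▷ A) zero    = qq A
  vars (γ ▷ A) (suc i) = vars γ i [ p ]p

  mutual
    WfTm : ∀ γ → Raw (len γ) → Set
    WfTm γ (var i)    = ⊤
    WfTm γ (gen g rs) = WfTmGen γ (sig g) rs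
    WfTm γ junk       = ⊥

    -- The signature is a separate argument so that it can be matched on without abstracting over
    -- `sig g`, while the recursion stays structural in the raw tuple.
    WfTmGen : ∀ γ → Gen → ∀ {m} → Raws (len γ) m → Set
    WfTmGen γ (tyGen δ T)   rs = ⊥
    WfTmGen γ (tmGen δ A a) rs = WfS γ rs δ

    WfS : ∀ γ {m} → Raws (len γ) m → Ctx → Set
    WfS γ []       ∙       = ⊤
    WfS γ []       (δ ▷ A) = ⊥
    WfS γ (rs ▸ r) ∙       = ⊥
    WfS γ (rs ▸ r) (δ ▷ A) =
      Σ (WfS γ rs δ) λ ws → Σ (WfTm γ r) λ w → proj₁ (evTm γ r w) ≡ A [ evS γ rs δ ws ]T

    evTm : ∀ γ r → WfTm γ r → TTm ⟦ γ ⟧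
    evTm γ (var i)    w = vars γ i
    evTm γ (gen g rs) w = evTmGen γ (sig g) rs w

    evTmGen : ∀ γ c {m} (rs : Raws (len γ) m) → WfTmGen γ c rs → TTm ⟦ γ ⟧
    evTmGen γ (tmGen δ A a) rs w = (A , a) [ evS γ rs δ w ]p

    evS : ∀ γ {m} (rs : Raws (len γ) m) δ → WfS γ rs δ → Hom ⟦ γ ⟧ ⟦ δ ⟧
    evS γ []       ∙       ws            = ε
    evS γ (rs ▸ r) (δ ▷ A) (ws , w , e) = ext (evS γ rs δ ws) (evTm γ r w) e

  WfTyGen : ∀ γ → Gen → ∀ {m} → Raws (len γ) m → Set
  WfTyGen γ (tyGen δ T)   rs = WfS γ rs δ
  WfTyGen γ (tmGen δ A a) rs = ⊥

  WfTy : ∀ γ → Raw (len γ) → Set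
  WfTy γ (var i)    = ⊥
  WfTy γ (gen g rs) = WfTyGen γ (sig g) rs
  WfTy γ junk       = ⊥

  evTyGen : ∀ γ c {m} (rs : Raws (len γ) m) → WfTyGen γ c rs → Ty ⟦ γ ⟧
  evTyGen γ (tyGen δ T) rs w = T [ evS γ rs δ w ]T

  evTy : ∀ γ r → WfTy γ r → Ty ⟦ γ ⟧
  evTy γ (gen g rs) w = evTyGen γ (sig g) rs w

  mutual
    WfTm-prop : ∀ γ r (w w' : WfTm γ r) → w ≡ w'
    WfTm-prop γ (var i)    w w' = refl
    WfTm-prop γ (gen g rs) w w' = WfTmGen-prop γ (sig g) rs w w'

    WfTmGen-prop : ∀ γ c {m} (rs : Raws (len γ) m) (w w' : WfTmGen γ c rs) → w ≡ w'
    WfTmGen-prop γ (tmGen δ A a) rs w w' = WfS-prop γ rs δ w w'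

    WfS-prop : ∀ γ {m} (rs : Raws (len γ) m) δ (w w' : WfS γ rs δ) → w ≡ w'
    WfS-prop γ []       ∙       w w' = refl
    WfS-prop γ (rs ▸ r) (δ ▷ A) (ws , w , e) (ws' , w' , e')
      with WfS-prop γ rs δ ws ws' | WfTm-prop γ r w w'
    ... | refl | refl = cong (λ x → ws , w , x) (uip e e')

  WfTy-prop : ∀ γ r (w w' : WfTy γ r) → w ≡ w'
  WfTy-prop γ (gen g rs) w w' with sig g
  ... | tyGen δ T = WfS-prop γ rs δ w w'

  -- The graph of the partial interpretation. Statements about the graph compose like typing rules
  -- and keep the proof of well-typedness out of the types of other statements.
  record HasTm (γ : Ctx) (r : Raw (len γ)) (s : TTm ⟦ γ ⟧) : Set where
    constructor has
    field
      wf : WfTm γ r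
      ev : evTm γ r wf ≡ s

  record HasTy (γ : Ctx) (r : Raw (len γ)) (A : Ty ⟦ γ ⟧) : Set where
    constructor has
    field
      wf : WfTy γ r
      ev : evTy γ r wf ≡ A

  record HasS (γ δ : Ctx) {m : ℕ} (rs : Raws (len γ) m) (σ : Hom ⟦ γ ⟧ ⟦ δ ⟧) : Set where
    constructor has
    field
      wf : WfS γ rs δ
      ev : evS γ rs δ wf ≡ σ

  open HasTm public renaming (wf to wfTm; ev to ev-Tm)
  open HasTy public renaming (wf to wfTy; ev to ev-Ty)
  open HasS public renaming (wf to wfS; ev to ev-S)

  hasTy : ∀ {γ r} (w : WfTy γ r) → HasTy γ r (evTy γ r w)
  hasTy w = has w refl

  hasS : ∀ {γ δ m} {rs : Raws (len γ) m} (w : WfS γ rs δ) → HasS γ δ rs (evS γ rs δ w)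
  hasS w = has w refl

  hasTm-≡ : ∀ {γ r s s'} → s ≡ s' → HasTm γ r s → HasTm γ r s'
  hasTm-≡ refl h = h

  hasS-≡ : ∀ {γ δ m} {rs : Raws (len γ) m} {σ σ'} → σ ≡ σ' → HasS γ δ rs σ → HasS γ δ rs σ'
  hasS-≡ refl h = h

  hasTm-det : ∀ {γ r s s'} → HasTm γ r s → HasTm γ r s' → s ≡ s'
  hasTm-det {γ} {r} (has w refl) (has w' e) = trans (cong (evTm γ r) (WfTm-prop γ r w w')) e

  hasTy-det : ∀ {γ r A A'} → HasTy γ r A → HasTy γ r A' → A ≡ A'
  hasTy-det {γ} {r} (has w refl) (has w' e) = trans (cong (evTy γ r) (WfTy-prop γ r w w')) e

  hasS-det : ∀ {γ δ m} {rs : Raws (len γ) m} {σ σ'} → HasS γ δ rs σ → HasS γ δ rs σ' → σ ≡ σ'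
  hasS-det {γ} {δ} {rs = rs} (has w refl) (has w' e) =
    trans (cong (evS γ rs δ) (WfS-prop γ rs δ w w')) e

  -- The conclusion concerns an arbitrary `ρ` rather than a pairing, so identities, projections and
  -- composites need not be rewritten as pairings first.
  hasS-▸ : ∀ {γ δ m A} {rs : Raws (len γ) m} {r} {ρ : Hom ⟦ γ ⟧ (⟦ δ ⟧ ▹ A)} →
           HasS γ δ rs (p ∘ ρ) → HasTm γ r (qq A [ ρ ]p) → HasS γ (δ ▷ A) (rs ▸ r) ρ
  hasS-▸ {A = A} {ρ = ρ} (has ws es) (has w e) =
    has (ws , w , e') (ext-η ρ _ _ e' es e)
    where
    e' = trans (cong proj₁ e) (trans (sym ([∘]T A p ρ)) (cong (A [_]T) (sym es)))

  hasS-ε : ∀ {γ} (ρ : Hom ⟦ γ ⟧ ◇) → HasS γ ∙ [] ρ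
  hasS-ε ρ = has tt (ε-η' ε ρ)

  hasS-tail : ∀ {γ δ m A} {rs : Raws (len γ) m} {r} {ρ : Hom ⟦ γ ⟧ (⟦ δ ⟧ ▹ A)} →
              HasS γ (δ ▷ A) (rs ▸ r) ρ → HasS γ δ rs (p ∘ ρ)
  hasS-tail (has (ws , w , e) refl) = has ws (sym (p-ext _ _ e))

  hasS-head : ∀ {γ δ m A} {rs : Raws (len γ) m} {r} {ρ : Hom ⟦ γ ⟧ (⟦ δ ⟧ ▹ A)} →
              HasS γ (δ ▷ A) (rs ▸ r) ρ → HasTm γ r (qq A [ ρ ]p)
  hasS-head (has (ws , w , e) refl) = has w (sym (qq-ext _ _ e))

  hasS-tabulate : ∀ γ δ (σ : Hom ⟦ γ ⟧ ⟦ δ ⟧) (f : Fin (len δ) → Raw (len γ)) →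
                  (∀ i → HasTm γ (f i) (vars δ i [ σ ]p)) → HasS γ δ (tabulate f) σ
  hasS-tabulate γ ∙       σ f h = hasS-ε σ
  hasS-tabulate γ (δ ▷ A) σ f h =
    hasS-▸ (hasS-tabulate γ δ (p ∘ σ) (λ i → f (suc i)) λ i →
              hasTm-≡ (sym ([∘]p (vars δ i) p σ)) (h (suc i)))
           (h zero)

  hasS-ids : ∀ {γ} → HasS γ γ ids id
  hasS-ids {γ} = hasS-tabulate γ γ id var λ i → has tt (sym ([id]p (vars γ i)))

  hasS-wk : ∀ {γ A} → HasS (γ ▷ A) γ wk p
  hasS-wk {γ} {A} = hasS-tabulate (γ ▷ A) γ p _ λ i → has tt refl

  hasTm-lookup : ∀ {γ} δ {rs : Raws (len γ) (len δ)} {σ} → HasS γ δ rs σ → ∀ i →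
                 HasTm γ (lookup rs i) (vars δ i [ σ ]p)
  hasTm-lookup (δ ▷ A) {rs ▸ r} h zero    = hasS-head h
  hasTm-lookup (δ ▷ A) {rs ▸ r} h (suc i) =
    hasTm-≡ ([∘]p (vars δ i) p _) (hasTm-lookup δ (hasS-tail h) i)

  module _ {γ θ : Ctx} {s : Raws (len θ) (len γ)} {τ : Hom ⟦ θ ⟧ ⟦ γ ⟧} (hs : HasS θ γ s τ) where
    mutual
      sub-Tm : ∀ r (w : WfTm γ r) → HasTm θ (r [ s ]) (evTm γ r w [ τ ]p)
      sub-Tm (var i)    w = hasTm-lookup γ hs i
      sub-Tm (gen g rs) w = has (proj₁ h) (proj₂ h)
        where h = sub-TmGen (sig g) rs w

      sub-TmGen : ∀ c {m} (rs : Raws (len γ) m) (w : WfTmGen γ c rs) →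
                  Σ (WfTmGen θ c (rs ⊙ s)) λ w' →
                    evTmGen θ c (rs ⊙ s) w' ≡ evTmGen γ c rs w [ τ ]p
      sub-TmGen (tmGen δ A a) rs w =
        wfS h , trans (cong ((A , a) [_]p) (ev-S h)) ([∘]p (A , a) _ _)
        where h = sub-S rs δ w

      sub-S : ∀ {m} (rs : Raws (len γ) m) δ (w : WfS γ rs δ) →
              HasS θ δ (rs ⊙ s) (evS γ rs δ w ∘ τ)
      sub-S []       ∙       w = hasS-ε _
      sub-S (rs ▸ r) (δ ▷ A) (us , u , e) = hasS-▸
        (hasS-≡ (trans (cong (_∘ τ) (sym (p-ext _ _ e))) (ass p _ _)) (sub-S rs δ us))
        (hasTm-≡ (trans (cong (_[ τ ]p) (sym (qq-ext _ _ e))) (sym ([∘]p (qq A) _ _)))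
                 (sub-Tm r u))

    sub-Ty : ∀ r (w : WfTy γ r) → HasTy θ (r [ s ]) (evTy γ r w [ τ ]T)
    sub-Ty (gen g rs) w = has (proj₁ h) (proj₂ h)
      where
      sub-TyGen : ∀ c {m} (rs : Raws (len γ) m) (w : WfTyGen γ c rs) →
                  Σ (WfTyGen θ c (rs ⊙ s)) λ w' →
                    evTyGen θ c (rs ⊙ s) w' ≡ evTyGen γ c rs w [ τ ]T
      sub-TyGen (tyGen δ T) rs w = wfS h , trans (cong (T [_]T) (ev-S h)) ([∘]T T _ _)
        where h = sub-S rs δ w
      h = sub-TyGen (sig g) rs w

  hasTm-sub : ∀ {γ θ r s rs σ} → HasTm γ r s → HasS θ γ rs σ → HasTm θ (r [ rs ]) (s [ σ ]p)
  hasTm-sub {r = r} (has w refl) hs = sub-Tm hs r w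

  hasTy-sub : ∀ {γ θ r A rs σ} → HasTy γ r A → HasS θ γ rs σ → HasTy θ (r [ rs ]) (A [ σ ]T)
  hasTy-sub {r = r} (has w refl) hs = sub-Ty hs r w

  hasS-∘ : ∀ {γ θ δ m} {rs : Raws (len γ) m} {ss σ τ} → HasS γ δ rs σ → HasS θ γ ss τ →
           HasS θ δ (rs ⊙ ss) (σ ∘ τ)
  hasS-∘ (has w refl) hs = sub-S hs _ _ w

  hasTm-gen : ∀ {g δ A a} → sig g ≡ tmGen δ A a → ∀ {γ m} {rs : Raws (len γ) m} {σ} →
              HasS γ δ rs σ → HasTm γ (gen g rs) ((A , a) [ σ ]p)
  hasTm-gen {g} {δ} {A} {a} e {γ} {_} {rs} (has w refl) = has (proj₁ h) (proj₂ h)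
    where
    h : Σ (WfTmGen γ (sig g) rs) λ w' → evTmGen γ (sig g) rs w' ≡ (A , a) [ evS γ rs δ w ]p
    h rewrite e = w , refl

  hasTy-gen : ∀ {g δ T} → sig g ≡ tyGen δ T → ∀ {γ m} {rs : Raws (len γ) m} {σ} →
              HasS γ δ rs σ → HasTy γ (gen g rs) (T [ σ ]T)
  hasTy-gen {g} {δ} {T} e {γ} {_} {rs} (has w refl) = has (proj₁ h) (proj₂ h)
    where
    h : Σ (WfTyGen γ (sig g) rs) λ w' → evTyGen γ (sig g) rs w' ≡ T [ evS γ rs δ w ]T
    h rewrite e = w , refl

  record GenTm (γ : Ctx) (g : G) {m : ℕ} (rs : Raws (len γ) m) (s : TTm ⟦ γ ⟧) : Set where
    constructor mk
    field
      {δ} : Ctx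
      t   : TTm ⟦ δ ⟧
      sg  : sig g ≡ tmGen δ (proj₁ t) (proj₂ t)
      {σ} : Hom ⟦ γ ⟧ ⟦ δ ⟧
      hs  : HasS γ δ rs σ
      eq  : s ≡ t [ σ ]p

  record GenTy (γ : Ctx) (g : G) {m : ℕ} (rs : Raws (len γ) m) (B : Ty ⟦ γ ⟧) : Set where
    constructor mk
    field
      {δ} : Ctx
      T   : Ty ⟦ δ ⟧
      sg  : sig g ≡ tyGen δ T
      {σ} : Hom ⟦ γ ⟧ ⟦ δ ⟧
      hs  : HasS γ δ rs σ
      eq  : B ≡ T [ σ ]T

  genTm : ∀ {g γ m} {rs : Raws (len γ) m} {s} → HasTm γ (gen g rs) s → GenTm γ g rs s
  genTm {g} {γ} {_} {rs} (has w refl) = aux (sig g) refl w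
    where
    aux : ∀ c → sig g ≡ c → (w : WfTmGen γ c rs) → GenTm γ g rs (evTmGen γ c rs w)
    aux (tmGen δ A a) e w = mk (A , a) e (hasS w) refl

  genTy : ∀ {g γ m} {rs : Raws (len γ) m} {B} → HasTy γ (gen g rs) B → GenTy γ g rs B
  genTy {g} {γ} {_} {rs} (has w refl) = aux (sig g) refl w
    where
    aux : ∀ c → sig g ≡ c → (w : WfTyGen γ c rs) → GenTy γ g rs (evTyGen γ c rs w)
    aux (tyGen δ T) e w = mk T e (hasS w) refl

-- The CwF of well-typed raw syntax and its interpretation in `C`.

module WellTyped (C : CwF) (G : Set) (sig : G → Contexts.Gen C) where
  open CwF C
  open Typing C G sig

  record Homᵂ (θ γ : Ctx) : Set where
    constructor homᵂ
    field
      raw : Raws (len θ) (len γ)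
      wf  : WfS θ raw γ
    den : Hom ⟦ θ ⟧ ⟦ γ ⟧
    den = evS θ raw γ wf
    typed : HasS θ γ raw den
    typed = hasS wf

  record Tyᵂ (γ : Ctx) : Set where
    constructor tyᵂ
    field
      raw : Raw (len γ)
      wf  : WfTy γ raw
    den : Ty ⟦ γ ⟧
    den = evTy γ raw wf
    typed : HasTy γ raw den
    typed = hasTy wf

  record Tmᵂ (γ : Ctx) (A : Tyᵂ γ) : Set where
    constructor tmᵂ
    field
      raw   : Raw (len γ)
      wf    : WfTm γ raw
      ty-wf : proj₁ (evTm γ raw wf) ≡ Tyᵂ.den A
    den : Tm ⟦ γ ⟧ (Tyᵂ.den A)
    den = subst (Tm ⟦ γ ⟧) ty-wf (proj₂ (evTm γ raw wf))
    typed : HasTm γ raw (Tyᵂ.den A , den)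
    typed = has wf (pair≡ ty-wf (Het.sym (≡-subst-removable (Tm ⟦ γ ⟧) ty-wf _)))

  private
    module H = Homᵂ
    module T = Tyᵂ
    module M = Tmᵂ

    Hom≡ : ∀ {θ γ} {σ τ : Homᵂ θ γ} → H.raw σ ≡ H.raw τ → σ ≡ τ
    Hom≡ {θ} {γ} {homᵂ rs w} {homᵂ _ w'} refl = cong (homᵂ rs) (WfS-prop θ rs γ w w')

    Ty≡ : ∀ {γ} {A B : Tyᵂ γ} → T.raw A ≡ T.raw B → A ≡ B
    Ty≡ {γ} {tyᵂ r w} {tyᵂ _ w'} refl = cong (tyᵂ r) (WfTy-prop γ r w w')

    Tm≅ : ∀ {γ} {A B : Tyᵂ γ} {t : Tmᵂ γ A} {u : Tmᵂ γ B} → A ≡ B → M.raw t ≡ M.raw u → t ≅ u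
    Tm≅ {γ} {t = tmᵂ r w e} {tmᵂ _ w' e'} refl refl with WfTm-prop γ r w w'
    ... | refl = ≡-to-≅ (cong (tmᵂ r w) (uip e e'))

    raw≡ : ∀ {γ} {A B : Tyᵂ γ} {t : Tmᵂ γ A} {u : Tmᵂ γ B} → A ≡ B → t ≅ u → M.raw t ≡ M.raw u
    raw≡ refl refl = refl

    raw-subst : ∀ {γ} {A B : Tyᵂ γ} (e : A ≡ B) (t : Tmᵂ γ A) → M.raw (subst (Tmᵂ γ) e t) ≡ M.raw t
    raw-subst refl t = refl

    homOf : ∀ {θ γ} {rs : Raws (len θ) (len γ)} {σ} → HasS θ γ rs σ → Homᵂ θ γ
    homOf {rs = rs} h = homᵂ rs (wfS h)

    tyOf : ∀ {γ} {r : Raw (len γ)} {A} → HasTy γ r A → Tyᵂ γ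
    tyOf {r = r} h = tyᵂ r (wfTy h)

    tmOf : ∀ {γ} (A : Tyᵂ γ) {r : Raw (len γ)} {s} → HasTm γ r s → proj₁ s ≡ T.den A → Tmᵂ γ A
    tmOf A {r} (has w e) e' = tmᵂ r w (trans (cong proj₁ e) e')

    tmOf-den : ∀ {γ} (A : Tyᵂ γ) {r : Raw (len γ)} {s} (h : HasTm γ r s) (e : proj₁ s ≡ T.den A) →
               M.den (tmOf A h e) ≅ proj₂ s
    tmOf-den A h e = pair≅ (hasTm-det (M.typed (tmOf A h e)) h)

    infixl 8 _[_]Tᵂ
    _[_]Tᵂ : ∀ {γ θ} → Tyᵂ γ → Homᵂ θ γ → Tyᵂ θ
    A [ σ ]Tᵂ = tyOf (hasTy-sub (T.typed A) (H.typed σ))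

    den-[]T : ∀ {γ θ} (A : Tyᵂ γ) (σ : Homᵂ θ γ) → T.den (A [ σ ]Tᵂ) ≡ T.den A [ H.den σ ]T
    den-[]T A σ = ev-Ty (hasTy-sub (T.typed A) (H.typed σ))

    wkᵂ : ∀ {γ A} → Homᵂ (γ ▷ A) γ
    wkᵂ = homOf hasS-wk

    den-[wk]T : ∀ {γ} (A : Tyᵂ γ) {B} → T.den (A [ wkᵂ {A = B} ]Tᵂ) ≡ T.den A [ p ]T
    den-[wk]T {γ} A {B} = trans (den-[]T A wkᵂ) (cong (T.den A [_]T) (ev-S (hasS-wk {γ} {B})))

    wk▸T : ∀ {γ θ} (A : Tyᵂ γ) {B} (σ : Homᵂ θ (γ ▷ B)) {rs r} → H.raw σ ≡ rs ▸ r →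
           T.raw (A [ wkᵂ {A = B} ]Tᵂ [ σ ]Tᵂ) ≡ T.raw A [ rs ]
    wk▸T A σ {rs} {r} refl = trans (sym ([⊙] (T.raw A) wk (rs ▸ r))) (cong (T.raw A [_]) (wk-⊙ rs r))

    pairᵂ : ∀ {γ θ} {A : Tyᵂ γ} (σ : Homᵂ θ γ) → Tmᵂ θ (A [ σ ]Tᵂ) → Homᵂ θ (γ ▷ T.den A)
    pairᵂ {A = A} σ t =
      homᵂ (H.raw σ ▸ M.raw t) (H.wf σ , M.wf t , trans (M.ty-wf t) (den-[]T A σ))

  -- Well-formedness being a proposition, every law reduces to one of the substitution calculus.
  -- Context extension adjoins the denotation of the raw type, so that `P` preserves it on the nose.
  W : CwF
  W = record
    { Ob = Ctx ; Hom = Homᵂ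
    ; id = homOf hasS-ids
    ; _∘_ = λ σ τ → homOf (hasS-∘ (H.typed σ) (H.typed τ))
    ; idl = λ σ → Hom≡ (ids-⊙ (H.raw σ))
    ; idr = λ σ → Hom≡ (⊙-ids (H.raw σ))
    ; ass = λ σ τ υ → Hom≡ (⊙-assoc (H.raw σ) (H.raw τ) (H.raw υ))
    ; ◇ = ∙ ; ε = homᵂ [] tt ; ε-η = λ { (homᵂ [] tt) → refl }
    ; Ty = Tyᵂ ; _[_]T = _[_]Tᵂ
    ; [id]T = λ A → Ty≡ ([ids] (T.raw A))
    ; [∘]T = λ A σ τ → Ty≡ ([⊙] (T.raw A) (H.raw σ) (H.raw τ))
    ; Tm = Tmᵂ
    ; _[_]t = λ {_} {_} {A} t σ →
        tmOf (A [ σ ]Tᵂ) (hasTm-sub (M.typed t) (H.typed σ)) (sym (den-[]T A σ))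
    ; [id]t = λ {_} {A} t → Tm≅ (Ty≡ ([ids] (T.raw A))) ([ids] (M.raw t))
    ; [∘]t = λ {_} {_} {_} {A} t σ τ →
        Tm≅ (Ty≡ ([⊙] (T.raw A) (H.raw σ) (H.raw τ))) ([⊙] (M.raw t) (H.raw σ) (H.raw τ))
    ; _▹_ = λ γ A → γ ▷ T.den A
    ; p = wkᵂ
    ; q = λ {γ} {A} → tmᵂ (var zero) tt (sym (den-[wk]T A))
    ; ⟨_,_⟩ = λ {_} {_} {A} → pairᵂ {A = A}
    ; p∘⟨⟩ = λ σ t → Hom≡ (wk-⊙ (H.raw σ) (M.raw t))
    ; q[⟨⟩] = λ {_} {_} {A} σ t → Tm≅ (Ty≡ (wk▸T A (pairᵂ {A = A} σ t) refl)) refl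
    ; ⟨⟩-η = λ { {A = A} (homᵂ (rs ▸ r) w) (homᵂ (rs' ▸ r') w') e e' →
        let es = trans (sym (wk-⊙ rs r)) (trans (cong H.raw e) (wk-⊙ rs' r')) in
        Hom≡ (cong₂ _▸_ es (raw≡ (Ty≡
          (trans (wk▸T A (homᵂ (rs ▸ r) w) refl)
          (trans (cong (T.raw A [_]) es) (sym (wk▸T A (homᵂ (rs' ▸ r') w') refl))))) e')) }
    ; ⟨⟩∘ = λ {_} {_} {_} {A} σ t τ → Hom≡ (cong (H.raw σ ⊙ H.raw τ ▸_)
        (sym (raw-subst (sym (Ty≡ ([⊙] (T.raw A) (H.raw σ) (H.raw τ)))) _)))
    }

  P : Mor W C
  P = record
    { ob = ⟦_⟧
    ; hom = H.den
    ; hom-id = λ {γ} → ev-S (hasS-ids {γ})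
    ; hom-∘ = λ σ τ → ev-S (hasS-∘ (H.typed σ) (H.typed τ))
    ; ob-◇ = refl
    ; ty = T.den
    ; ty-sub = den-[]T
    ; tm = M.den
    ; tm-sub = λ {_} {_} {A} t σ →
        tmOf-den (A [ σ ]Tᵂ) (hasTm-sub (M.typed t) (H.typed σ)) (sym (den-[]T A σ))
    ; ob-▹ = λ A → refl
    ; hom-p = λ {γ} A → ≡-to-≅ (ev-S (hasS-wk {γ} {T.den A}))
    ; tm-q = λ A → pair≅ (sym (ev-Tm (M.typed (CwF.q W {A = A}))))
    }

-- Congruence and composition for morphisms of CwFs.

module CwFCong (C : CwF) where
  open CwF C

  []T-cong : ∀ {Γ Γ' Δ Δ'} → Γ ≡ Γ' → Δ ≡ Δ' → {A : Ty Γ} {A' : Ty Γ'} → A ≅ A' →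
             {σ : Hom Δ Γ} {σ' : Hom Δ' Γ'} → σ ≅ σ' → A [ σ ]T ≅ A' [ σ' ]T
  []T-cong refl refl refl refl = refl

module MorCong {C D : CwF} (F : Mor C D) where
  private
    module C = CwF C
    module D = CwF D
  open Mor F

  hom-cong : ∀ {Γ Γ' Δ Δ'} → Γ ≡ Γ' → Δ ≡ Δ' → {σ : C.Hom Δ Γ} {σ' : C.Hom Δ' Γ'} →
             σ ≅ σ' → hom σ ≅ hom σ'
  hom-cong refl refl refl = refl

  ty-cong : ∀ {Γ Γ'} → Γ ≡ Γ' → {A : C.Ty Γ} {A' : C.Ty Γ'} → A ≅ A' → ty A ≅ ty A'
  ty-cong refl refl = refl

  tm-cong : ∀ {Γ Γ'} → Γ ≡ Γ' → {A : C.Ty Γ} {A' : C.Ty Γ'} → A ≅ A' →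
            {t : C.Tm Γ A} {t' : C.Tm Γ' A'} → t ≅ t' → tm t ≅ tm t'
  tm-cong refl refl refl = refl

  ty-wk : ∀ {Γ} (A B : C.Ty Γ) → ty (A C.[ C.p {A = B} ]T) ≅ ty A D.[ D.p {A = ty B} ]T
  ty-wk A B = Het.trans (≡-to-≅ (ty-sub A C.p))
    (CwFCong.[]T-cong D refl (ob-▹ B) refl (hom-p B))

idMor : ∀ {C} → Mor C C
idMor = record
  { ob = λ Γ → Γ ; hom = λ σ → σ ; hom-id = refl ; hom-∘ = λ _ _ → refl ; ob-◇ = refl
  ; ty = λ A → A ; ty-sub = λ _ _ → refl ; tm = λ t → t ; tm-sub = λ _ _ → refl
  ; ob-▹ = λ _ → refl ; hom-p = λ _ → refl ; tm-q = λ _ → refl }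

infixr 9 _∘M_
_∘M_ : ∀ {C D E} → Mor D E → Mor C D → Mor C E
_∘M_ {C} {D} {E} G F = record
  { ob = λ Γ → G.ob (F.ob Γ)
  ; hom = λ σ → G.hom (F.hom σ)
  ; hom-id = trans (cong G.hom F.hom-id) G.hom-id
  ; hom-∘ = λ σ τ → trans (cong G.hom (F.hom-∘ σ τ)) (G.hom-∘ _ _)
  ; ob-◇ = trans (cong G.ob F.ob-◇) G.ob-◇
  ; ty = λ A → G.ty (F.ty A)
  ; ty-sub = λ A σ → trans (cong G.ty (F.ty-sub A σ)) (G.ty-sub _ _)
  ; tm = λ t → G.tm (F.tm t)
  ; tm-sub = λ {_} {_} {A} t σ → Het.trans
      (MorCong.tm-cong G refl (≡-to-≅ (F.ty-sub A σ)) (F.tm-sub t σ)) (G.tm-sub _ _)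
  ; ob-▹ = λ A → trans (cong G.ob (F.ob-▹ A)) (G.ob-▹ _)
  ; hom-p = λ A → Het.trans (MorCong.hom-cong G refl (F.ob-▹ A) (F.hom-p A)) (G.hom-p _)
  ; tm-q = λ A → Het.trans
      (MorCong.tm-cong G (F.ob-▹ A) (MorCong.ty-wk F A A) (F.tm-q A)) (G.tm-q _)
  }
  where
  module F = Mor F
  module G = Mor G

module _ {C D E : CwF} {H : Mor D E} {F : Mor C D} {G : Mor C E} where
  ≐⇒Comp≐ : (H ∘M F) ≐ G → Comp≐ H F G
  ≐⇒Comp≐ e = record { ob≐ = E.ob≐ ; hom≐ = E.hom≐ ; ty≐ = E.ty≐ ; tm≐ = E.tm≐ }
    where module E = _≐_ e

≐-sym : ∀ {C D} {F G : Mor C D} → F ≐ G → G ≐ F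
≐-sym e = record
  { ob≐ = λ Γ → sym (E.ob≐ Γ) ; hom≐ = λ σ → Het.sym (E.hom≐ σ)
  ; ty≐ = λ A → Het.sym (E.ty≐ A) ; tm≐ = λ t → Het.sym (E.tm≐ t) }
  where module E = _≐_ e

≐-trans : ∀ {C D} {F G H : Mor C D} → F ≐ G → G ≐ H → F ≐ H
≐-trans e e' = record
  { ob≐ = λ Γ → trans (E.ob≐ Γ) (E'.ob≐ Γ) ; hom≐ = λ σ → Het.trans (E.hom≐ σ) (E'.hom≐ σ)
  ; ty≐ = λ A → Het.trans (E.ty≐ A) (E'.ty≐ A) ; tm≐ = λ t → Het.trans (E.tm≐ t) (E'.tm≐ t) }
  where
  module E = _≐_ e
  module E' = _≐_ e'

∘M-Comp≐ : ∀ {B C D E} {P : Mor D E} {H : Mor C D} {f : Mor B C} {F : Mor B D} {G : Mor B E} →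
           Comp≐ H f F → Comp≐ P F G → Comp≐ (P ∘M H) f G
∘M-Comp≐ {P = P} a b = record
  { ob≐ = λ Γ → trans (cong P.ob (A.ob≐ Γ)) (B.ob≐ Γ)
  ; hom≐ = λ σ → Het.trans (MorCong.hom-cong P (A.ob≐ _) (A.ob≐ _) (A.hom≐ σ)) (B.hom≐ σ)
  ; ty≐ = λ T → Het.trans (MorCong.ty-cong P (A.ob≐ _) (A.ty≐ T)) (B.ty≐ T)
  ; tm≐ = λ t → Het.trans (MorCong.tm-cong P (A.ob≐ _) (A.ty≐ _) (A.tm≐ t)) (B.tm≐ t) }
  where
  module P = Mor P
  module A = Comp≐ a
  module B = Comp≐ b

Comp≐-∘M : ∀ {C D E} (H : Mor D E) (F : Mor C D) → Comp≐ H F (H ∘M F)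
Comp≐-∘M H F = record
  { ob≐ = λ _ → refl ; hom≐ = λ _ → refl ; ty≐ = λ _ → refl ; tm≐ = λ _ → refl }

Comp≐-trans : ∀ {C D E} {P : Mor D E} {F : Mor C D} {G G' : Mor C E} →
              Comp≐ P F G → G ≐ G' → Comp≐ P F G'
Comp≐-trans a b = record
  { ob≐ = λ Γ → trans (A.ob≐ Γ) (B.ob≐ Γ) ; hom≐ = λ σ → Het.trans (A.hom≐ σ) (B.hom≐ σ)
  ; ty≐ = λ T → Het.trans (A.ty≐ T) (B.ty≐ T) ; tm≐ = λ t → Het.trans (A.tm≐ t) (B.tm≐ t) }
  where
  module A = Comp≐ a
  module B = _≐_ b

Comp≐⇒≐ : ∀ {C D E} {H : Mor D E} {F : Mor C D} {G : Mor C E} → Comp≐ H F G → (H ∘M F) ≐ G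
Comp≐⇒≐ e = record { ob≐ = E.ob≐ ; hom≐ = E.hom≐ ; ty≐ = E.ty≐ ; tm≐ = E.tm≐ }
  where module E = Comp≐ e

mapFill : ∀ {C D E} (H : Mor D E) (F : Mor C D) (c : Cell C) → Fill F c → Fill (H ∘M F) c
mapFill H F (tyCell Γ)   x = Mor.ty H x
mapFill H F (tmCell Γ A) x = Mor.tm H x

FillRel-∘M : ∀ {B C D E} {P : Mor D E} {H : Mor C D} {f : Mor B C} {F : Mor B D} {G : Mor B E} →
             Comp≐ H f F → (c : Cell B) {x : Fill f c} {y : Fill F c} {z : Fill G c} →
             FillRel H f F c x y → FillRel P F G c y z → FillRel (P ∘M H) f G c x z
FillRel-∘M {P = P} a (tyCell Γ)   r s =
  Het.trans (MorCong.ty-cong P (Comp≐.ob≐ a Γ) r) s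
FillRel-∘M {P = P} a (tmCell Γ A) r s =
  Het.trans (MorCong.tm-cong P (Comp≐.ob≐ a Γ) (Comp≐.ty≐ a A) r) s

FillRel-mapFill : ∀ {C D E} (H : Mor D E) (F : Mor C D) (c : Cell C) (x : Fill F c) →
                  FillRel H F (H ∘M F) c x (mapFill H F c x)
FillRel-mapFill H F (tyCell Γ)   x = refl
FillRel-mapFill H F (tmCell Γ A) x = refl

-- Sections over a cellular CwF.

module Cells (C : CwF) (cellular : IsICellular C) where
  Cs : ℕ → CwF
  Cs = proj₁ cellular

  fs : ∀ n → Mor (Cs n) (Cs (suc n))
  fs = proj₁ (proj₂ cellular)

  ι : ∀ n → Mor (Cs n) C
  ι = proj₁ (proj₂ (proj₂ cellular))

  initial : IsInitial (Cs 0)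
  initial = proj₁ (proj₂ (proj₂ (proj₂ cellular)))

  pushout : ∀ n → IsCellPushout (fs n)
  pushout = proj₁ (proj₂ (proj₂ (proj₂ (proj₂ cellular))))

  colimit : IsSeqColimit Cs fs C ι
  colimit = proj₂ (proj₂ (proj₂ (proj₂ (proj₂ cellular))))

  J : ℕ → Set
  J n = proj₁ (pushout n)

  cell : ∀ n → J n → Cell (Cs n)
  cell n = proj₁ (proj₂ (pushout n))

  cellGen : ∀ n j → Fill (fs n) (cell n j)
  cellGen n = proj₁ (proj₂ (proj₂ (pushout n)))

  -- This agrees with `ι n` only up to `≐`. The generators live in `Cs (suc n)`, and over `φ n`
  -- their images in `C` are typed without any transport.
  φ : ∀ n → Mor (Cs n) C
  φ n = ι (suc n) ∘M fs n

  genC : ∀ n j → Fill (φ n) (cell n j)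
  genC n j = mapFill (ι (suc n)) (fs n) (cell n j) (cellGen n j)

  φ≐ι : ∀ n → Comp≐ (ι (suc n)) (fs n) (ι n)
  φ≐ι = proj₁ colimit

  -- Induction principle of C: a morphism P has a section as soon as the generators lift along it.
  module Section (D : CwF) (P : Mor D C)
    (fill : ∀ n (F : Mor (Cs n) D) → Comp≐ P F (φ n) → ∀ j → Fill F (cell n j))
    (fill-over : ∀ n (F : Mor (Cs n) D) (o : Comp≐ P F (φ n)) → ∀ j →
                 FillRel P F (φ n) (cell n j) (fill n F o j) (genC n j))
    where

    record Stage (n : ℕ) : Set where
      constructor stage
      field
        F    : Mor (Cs n) D
        over : Comp≐ P F (ι n)
      overφ : Comp≐ P F (φ n)
      overφ = Comp≐-trans over (≐-sym (Comp≐⇒≐ (φ≐ι n)))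

    module Step {n : ℕ} (S : Stage n) where
      open Stage S

      filler : ∀ j → Fill F (cell n j)
      filler = fill n F overφ

      private
        push = proj₂ (proj₂ (proj₂ (pushout n))) D F filler
        pushC = proj₂ (proj₂ (proj₂ (pushout n))) C (φ n) (genC n)

      F' : Mor (Cs (suc n)) D
      F' = proj₁ push

      extends : Comp≐ F' (fs n) F
      extends = proj₁ (proj₁ (proj₂ push))

      F'-gen : ∀ j → FillRel F' (fs n) F (cell n j) (cellGen n j) (filler j)
      F'-gen = proj₂ (proj₁ (proj₂ push))

      next : Stage (suc n)
      -- Both `P ∘M F'` and `ι (suc n)` extend `φ n` and send the new generators to `genC n`, so
      -- uniqueness in the pushout identifies them.
      next = stage F' (≐⇒Comp≐ (≐-trans
        (proj₂ (proj₂ pushC) (P ∘M F') (∘M-Comp≐ extends overφ)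
          (λ j → FillRel-∘M {P = P} {G = φ n} extends (cell n j) (F'-gen j) (fill-over n F overφ j)))
        (≐-sym (proj₂ (proj₂ pushC) (ι (suc n)) (Comp≐-∘M (ι (suc n)) (fs n))
          (λ j → FillRel-mapFill (ι (suc n)) (fs n) (cell n j) (cellGen n j))))))

    stages : ∀ n → Stage n
    stages zero = stage (proj₁ (initial D))
      (≐⇒Comp≐ (≐-trans (proj₂ (initial C) _) (≐-sym (proj₂ (initial C) (ι 0)))))
    stages (suc n) = Step.next (stages n)

    F : ∀ n → Mor (Cs n) D
    F n = Stage.F (stages n)

    filler : ∀ n j → Fill (F n) (cell n j)
    filler n = Step.filler (stages n)

    private
      colim  = proj₂ colimit D F λ n → Step.extends (stages n)
      colimC = proj₂ (proj₂ (proj₂ colimit C ι φ≐ι))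

    H : Mor C D
    H = proj₁ colim

    H-ι : ∀ n → Comp≐ H (ι n) (F n)
    H-ι = proj₁ (proj₂ colim)

    section : (P ∘M H) ≐ idMor
    section = ≐-trans (colimC (P ∘M H) λ n → ∘M-Comp≐ (H-ι n) (Stage.over (stages n)))
      (≐-sym (colimC idMor λ n →
        record { ob≐ = λ _ → refl ; hom≐ = λ _ → refl ; ty≐ = λ _ → refl ; tm≐ = λ _ → refl }))

    H-gen : ∀ n j → FillRel H (φ n) (F n) (cell n j) (genC n j) (filler n j)
    H-gen n j = aux (cell n j) (cellGen n j) (filler n j) (Step.F'-gen (stages n) j)
      where
      aux : ∀ c (x : Fill (fs n) c) (y : Fill (F n) c) →
            FillRel (F (suc n)) (fs n) (F n) c x y →
            FillRel H (φ n) (F n) c (mapFill (ι (suc n)) (fs n) c x) y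
      aux (tyCell Γ)   x y r = Het.trans (Comp≐.ty≐ (H-ι (suc n)) x) r
      aux (tmCell Γ A) x y r = Het.trans (Comp≐.tm≐ (H-ι (suc n)) x) r

    H-φ : ∀ n Γ → Mor.ob H (Mor.ob (φ n) Γ) ≡ Mor.ob (F n) Γ
    H-φ n Γ = trans (cong (Mor.ob H) (Comp≐.ob≐ (φ≐ι n) Γ)) (Comp≐.ob≐ (H-ι n) Γ)

    H-φ-ty : ∀ n {Γ} (A : CwF.Ty (Cs n) Γ) → Mor.ty H (Mor.ty (φ n) A) ≅ Mor.ty (F n) A
    H-φ-ty n A = Het.trans (MorCong.ty-cong H (Comp≐.ob≐ (φ≐ι n) _) (Comp≐.ty≐ (φ≐ι n) A))
                           (Comp≐.ty≐ (H-ι n) A)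

-- Unique raw representatives of the types, terms and morphisms of `C`.

module Representation (C : CwF) (cellular : IsICellular C) where
  open CwF C
  open Cells C cellular
  open Contexts C public

  private
    module φ n = Mor (φ n)

  cellOb : ∀ {B} → Cell B → CwF.Ob B
  cellOb (tyCell Γ)   = Γ
  cellOb (tmCell Γ A) = Γ

  -- A label includes a decomposition of the context of its generator: the interpretation of raw
  -- syntax needs it before every object is known to have exactly one.
  Label : Set
  Label = Σ ℕ λ n → Σ (J n) λ j → Σ Ctx λ δ → ⟦ δ ⟧ ≡ φ.ob n (cellOb (cell n j))

  mkTyGen : ∀ {Γ} δ → ⟦ δ ⟧ ≡ Γ → Ty Γ → Gen
  mkTyGen δ refl T = tyGen δ T

  mkTmGen : ∀ {Γ} δ → ⟦ δ ⟧ ≡ Γ → (A : Ty Γ) → Tm Γ A → Gen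
  mkTmGen δ refl A a = tmGen δ A a

  sigOf : ∀ n (c : Cell (Cs n)) → Fill (φ n) c → ∀ δ → ⟦ δ ⟧ ≡ φ.ob n (cellOb c) → Gen
  sigOf n (tyCell Γ)   x δ e = mkTyGen δ e x
  sigOf n (tmCell Γ A) x δ e = mkTmGen δ e (φ.ty n A) x

  sig : Label → Gen
  sig (n , j , δ , e) = sigOf n (cell n j) (genC n j) δ e

  open Typing C Label sig public hiding (Ctx; ∙; _▷_; ⟦_⟧; len; Gen; tyGen; tmGen)
  open WellTyped C Label sig
  private
    module W = CwF W
    module HomW = Homᵂ
    module TyW = Tyᵂ
    module TmW = Tmᵂ

  rawFill : ∀ {n} (F : Mor (Cs n) W) (c : Cell (Cs n)) → Fill F c → Raw (len (Mor.ob F (cellOb c)))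
  rawFill F (tyCell Γ)   y = TyW.raw y
  rawFill F (tmCell Γ A) y = TmW.raw y

  -- The field `raw-is` remembers that a generator is lifted to its own label applied to the
  -- identity, which typing alone would not reveal. The label is abstracted as a function `lab`
  -- because a label mentions the index `j`, whereas the construction has to match on an arbitrary
  -- cell `c`.
  record Filling {n} (F : Mor (Cs n) W) (o : Comp≐ P F (φ n)) (c : Cell (Cs n)) (x : Fill (φ n) c)
                 (lab : ∀ δ → ⟦ δ ⟧ ≡ φ.ob n (cellOb c) → Label) : Set where
    constructor filling
    field
      fill   : Fill F c
      over   : FillRel P F (φ n) c fill x
      raw-is : rawFill F c fill ≡ gen (lab (Mor.ob F (cellOb c)) (Comp≐.ob≐ o (cellOb c))) ids

  fillTy : ∀ {γ Γ} (e : ⟦ γ ⟧ ≡ Γ) (T : Ty Γ) g → sig g ≡ mkTyGen γ e T →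
           Σ (Tyᵂ γ) λ B → TyW.den B ≅ T × TyW.raw B ≡ gen g ids
  fillTy {γ} refl T g sg = tyᵂ (gen g ids) (wfTy h) , ≡-to-≅ (trans (ev-Ty h) ([id]T T)) , refl
    where h = hasTy-gen sg (hasS-ids {γ})

  fillTm : ∀ {γ Γ} (e : ⟦ γ ⟧ ≡ Γ) (B : Tyᵂ γ) (A : Ty Γ) (a : Tm Γ A) g → TyW.den B ≅ A →
           sig g ≡ mkTmGen γ e A a → Σ (Tmᵂ γ B) λ t → TmW.den t ≅ a × TmW.raw t ≡ gen g ids
  fillTm {γ} refl B A a g eB sg = t , pair≅ (hasTm-det (TmW.typed t) h) , refl
    where
    h : HasTm γ (gen g ids) (A , a)
    h = hasTm-≡ ([id]p (A , a)) (hasTm-gen sg (hasS-ids {γ}))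
    t : Tmᵂ γ B
    t = tmᵂ (gen g ids) (wfTm h) (trans (cong proj₁ (ev-Tm h)) (sym (≅-to-≡ eB)))

  mkFilling : ∀ {n} (F : Mor (Cs n) W) (o : Comp≐ P F (φ n)) (c : Cell (Cs n)) (x : Fill (φ n) c)
              (lab : ∀ δ → ⟦ δ ⟧ ≡ φ.ob n (cellOb c) → Label) →
              (∀ δ e → sig (lab δ e) ≡ sigOf n c x δ e) → Filling F o c x lab
  mkFilling F o (tyCell Γ) x lab lab-sig = filling (proj₁ h) (proj₁ (proj₂ h)) (proj₂ (proj₂ h))
    where h = fillTy (Comp≐.ob≐ o Γ) x _ (lab-sig _ _)
  mkFilling F o (tmCell Γ A) x lab lab-sig = filling (proj₁ h) (proj₁ (proj₂ h)) (proj₂ (proj₂ h))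
    where h = fillTm (Comp≐.ob≐ o Γ) (Mor.ty F A) _ x _ (Comp≐.ty≐ o A) (lab-sig _ _)

  fillings : ∀ n (F : Mor (Cs n) W) (o : Comp≐ P F (φ n)) j →
             Filling F o (cell n j) (genC n j) (λ δ e → n , j , δ , e)
  fillings n F o j = mkFilling F o (cell n j) (genC n j) _ λ δ e → refl

  -- All that is used of the section from here on. The decomposition stored in the label of a
  -- generator is the one that `H` itself computes.
  record Retraction : Set where
    field
      H       : Mor C W
      section : (P ∘M H) ≐ idMor
      H-gen   : ∀ n j → let Γ = φ.ob n (cellOb (cell n j)) in Σ (⟦ Mor.ob H Γ ⟧ ≡ Γ) λ e →
                rawFill (H ∘M φ n) (cell n j) (mapFill H (φ n) (cell n j) (genC n j)) ≡
                gen (n , j , Mor.ob H Γ , e) ids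

  raw-≅ : ∀ {γ γ'} → γ ≡ γ' → {A : Tyᵂ γ} {A' : Tyᵂ γ'} → A ≅ A' →
          {t : Tmᵂ γ A} {t' : Tmᵂ γ' A'} → t ≅ t' → TmW.raw t ≅ TmW.raw t'
  raw-≅ refl refl refl = refl

  rawTy-≅ : ∀ {γ γ'} → γ ≡ γ' → {A : Tyᵂ γ} {A' : Tyᵂ γ'} → A ≅ A' → TyW.raw A ≅ TyW.raw A'
  rawTy-≅ refl refl = refl

  rawS-≅ : ∀ {θ θ' γ γ'} → θ ≡ θ' → γ ≡ γ' → {σ : Homᵂ θ γ} {σ' : Homᵂ θ' γ'} → σ ≅ σ' →
           HomW.raw σ ≅ HomW.raw σ'
  rawS-≅ refl refl refl = refl

  gen-label : ∀ {n j δ δ'} (e : ⟦ δ ⟧ ≡ φ.ob n (cellOb (cell n j)))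
              (e' : ⟦ δ' ⟧ ≡ φ.ob n (cellOb (cell n j))) → δ' ≡ δ →
              gen (n , j , δ' , e') (ids {len δ'}) ≅ gen (n , j , δ , e) (ids {len δ})
  gen-label e e' refl with uip e e'
  ... | refl = refl

  abstract
    retraction : Retraction
    retraction = record
      { H = S.H
      ; section = S.section
      ; H-gen = λ n j → let e = _≐_.ob≐ S.section (φ.ob n (cellOb (cell n j))) in
          e , ≅-to-≡ (Het.trans
            (aux n (cell n j) (genC n j) (S.filler n j) (S.H-gen n j))
            (Het.trans (≡-to-≅ (Filling.raw-is (fillings n (S.F n) _ j)))
                       (gen-label e _ (sym (S.H-φ n _)))))
      }
      where
      module S = Section W P (λ n F o j → Filling.fill (fillings n F o j))
                             (λ n F o j → Filling.over (fillings n F o j))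
      aux : ∀ n c (x : Fill (φ n) c) (y : Fill (S.F n) c) → FillRel S.H (φ n) (S.F n) c x y →
            rawFill (S.H ∘M φ n) c (mapFill S.H (φ n) c x) ≅ rawFill (S.F n) c y
      aux n (tyCell Γ)   x y r = rawTy-≅ (S.H-φ n Γ) r
      aux n (tmCell Γ A) x y r = raw-≅ (S.H-φ n Γ) (S.H-φ-ty n A) r

  open Retraction retraction

  private
    module H = Mor H
    module HC = MorCong H
    module PH = _≐_ section

  ▷-cong : ∀ {γ γ'} → γ ≡ γ' → {A : Ty ⟦ γ ⟧} {A' : Ty ⟦ γ' ⟧} → A ≅ A' → γ ▷ A ≡ γ' ▷ A'
  ▷-cong refl refl = refl

  -- Together with `section` this makes `⟦_⟧` a bijection between contexts and objects, which is
  -- contextuality of `C`. The induction uses that `H.ty A` denotes `A`.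
  H⟦_⟧ : ∀ γ → H.ob ⟦ γ ⟧ ≡ γ
  H⟦ ∙ ⟧     = H.ob-◇
  H⟦ γ ▷ A ⟧ = trans (H.ob-▹ A) (▷-cong H⟦ γ ⟧ (PH.ty≐ A))

  castR : ∀ {γ γ'} → γ' ≡ γ → Raw (len γ') → Raw (len γ)
  castR refl r = r

  castS : ∀ {γ γ' θ θ'} → θ' ≡ θ → γ' ≡ γ → Raws (len θ') (len γ') → Raws (len θ) (len γ)
  castS refl refl rs = rs

  castR-≅ : ∀ {γ γ'} (e : γ' ≡ γ) r → castR e r ≅ r
  castR-≅ refl r = refl

  castS-≅ : ∀ {γ γ' θ θ'} (e : θ' ≡ θ) (e' : γ' ≡ γ) rs → castS e e' rs ≅ rs
  castS-≅ refl refl rs = refl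

  castR-[] : ∀ {γ γ' θ θ'} (e : θ' ≡ θ) (e' : γ' ≡ γ) r rs →
             castR e (r [ rs ]) ≡ castR e' r [ castS e e' rs ]
  castR-[] refl refl r rs = refl

  castS-⊙ : ∀ {γ γ' δ δ' θ θ'} (e : θ' ≡ θ) (e' : γ' ≡ γ) (e'' : δ' ≡ δ) rs ss →
            castS e e'' (rs ⊙ ss) ≡ castS e' e'' rs ⊙ castS e e' ss
  castS-⊙ refl refl refl rs ss = refl

  rawTy : ∀ {γ} → Ty ⟦ γ ⟧ → Raw (len γ)
  rawTy {γ} A = castR H⟦ γ ⟧ (TyW.raw (H.ty A))

  rawTm : ∀ {γ} → TTm ⟦ γ ⟧ → Raw (len γ)
  rawTm {γ} (A , t) = castR H⟦ γ ⟧ (TmW.raw (H.tm t))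

  rawS : ∀ {θ γ} → Hom ⟦ θ ⟧ ⟦ γ ⟧ → Raws (len θ) (len γ)
  rawS {θ} {γ} σ = castS H⟦ θ ⟧ H⟦ γ ⟧ (HomW.raw (H.hom σ))

  rawTy-has : ∀ {γ} (A : Ty ⟦ γ ⟧) → HasTy γ (rawTy A) A
  rawTy-has {γ} A = aux H⟦ γ ⟧ (H.ty A) (PH.ty≐ A)
    where
    aux : ∀ {γ'} (e : γ' ≡ γ) (B : Tyᵂ γ') → TyW.den B ≅ A → HasTy γ (castR e (TyW.raw B)) A
    aux refl B refl = TyW.typed B

  rawTm-has : ∀ {γ} (s : TTm ⟦ γ ⟧) → HasTm γ (rawTm s) s
  rawTm-has {γ} (A , t) = aux H⟦ γ ⟧ (H.ty A) (H.tm t) (PH.ty≐ A) (PH.tm≐ t)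
    where
    aux : ∀ {γ'} (e : γ' ≡ γ) (B : Tyᵂ γ') (u : Tmᵂ γ' B) → TyW.den B ≅ A → TmW.den u ≅ t →
          HasTm γ (castR e (TmW.raw u)) (A , t)
    aux refl B u refl refl = TmW.typed u

  rawS-has : ∀ {θ γ} (σ : Hom ⟦ θ ⟧ ⟦ γ ⟧) → HasS θ γ (rawS σ) σ
  rawS-has {θ} {γ} σ = aux H⟦ θ ⟧ H⟦ γ ⟧ (H.hom σ) (PH.hom≐ σ)
    where
    aux : ∀ {θ' γ'} (e : θ' ≡ θ) (e' : γ' ≡ γ) (τ : Homᵂ θ' γ') → HomW.den τ ≅ σ →
          HasS θ γ (castS e e' (HomW.raw τ)) σ
    aux refl refl τ refl = HomW.typed τ

  rawTy-[] : ∀ {γ θ} (A : Ty ⟦ γ ⟧) (σ : Hom ⟦ θ ⟧ ⟦ γ ⟧) →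
             rawTy {θ} (A [ σ ]T) ≡ rawTy {γ} A [ rawS {θ} {γ} σ ]
  rawTy-[] {γ} {θ} A σ =
    trans (cong (λ B → castR H⟦ θ ⟧ (TyW.raw B)) (H.ty-sub A σ)) (castR-[] H⟦ θ ⟧ H⟦ γ ⟧ _ _)

  rawTm-[] : ∀ {γ θ} (s : TTm ⟦ γ ⟧) (σ : Hom ⟦ θ ⟧ ⟦ γ ⟧) →
             rawTm {θ} (s [ σ ]p) ≡ rawTm {γ} s [ rawS {θ} {γ} σ ]
  rawTm-[] {γ} {θ} (A , t) σ =
    trans (cong (castR H⟦ θ ⟧) (≅-to-≡ (raw-≅ refl (≡-to-≅ (H.ty-sub A σ)) (H.tm-sub t σ))))
          (castR-[] H⟦ θ ⟧ H⟦ γ ⟧ _ _)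

  rawS-∘ : ∀ {γ δ θ} (σ : Hom ⟦ γ ⟧ ⟦ δ ⟧) (τ : Hom ⟦ θ ⟧ ⟦ γ ⟧) →
           rawS {θ} {δ} (σ ∘ τ) ≡ rawS {γ} {δ} σ ⊙ rawS {θ} {γ} τ
  rawS-∘ {γ} {δ} {θ} σ τ =
    trans (cong (λ x → castS H⟦ θ ⟧ H⟦ δ ⟧ (HomW.raw x)) (H.hom-∘ σ τ))
          (castS-⊙ H⟦ θ ⟧ H⟦ γ ⟧ H⟦ δ ⟧ _ _)

  rawTm-qq : ∀ {γ} (A : Ty ⟦ γ ⟧) → rawTm {γ ▷ A} (qq A) ≡ var zero
  rawTm-qq {γ} A = ≅-to-≡ (Het.trans (castR-≅ H⟦ γ ▷ A ⟧ _)
    (Het.trans (raw-≅ (H.ob-▹ A) (HC.ty-wk A A) (H.tm-q A))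
               (Het.cong (λ γ → var {suc (len γ)} zero) (≡-to-≅ H⟦ γ ⟧))))

  rawS-p : ∀ {γ} (A : Ty ⟦ γ ⟧) → rawS {γ ▷ A} {γ} p ≡ wk
  rawS-p {γ} A = ≅-to-≡ (Het.trans (castS-≅ H⟦ γ ▷ A ⟧ H⟦ γ ⟧ _)
    (Het.trans (rawS-≅ (H.ob-▹ A) refl (H.hom-p A))
               (Het.cong (λ γ → wk {n = len γ}) (≡-to-≅ H⟦ γ ⟧))))

  rawTm-vars : ∀ γ i → rawTm {γ} (vars γ i) ≡ var i
  rawTm-vars (γ ▷ A) zero    = rawTm-qq A
  rawTm-vars (γ ▷ A) (suc i) = trans (rawTm-[] {γ} {γ ▷ A} (vars γ i) p)
    (trans (cong₂ _[_] (rawTm-vars γ i) (rawS-p A)) (lookup-tabulate (λ j → var (suc j)) i))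

  mkTyGen⁻¹ : ∀ {Γ δ γ} (e : ⟦ δ ⟧ ≡ Γ) {x : Ty Γ} {T : Ty ⟦ γ ⟧} → mkTyGen δ e x ≡ tyGen γ T →
              δ ≡ γ × T ≅ x
  mkTyGen⁻¹ refl refl = refl , refl

  mkTmGen⁻¹ : ∀ {Γ δ γ} (e : ⟦ δ ⟧ ≡ Γ) {B : Ty Γ} {x : Tm Γ B} {A : Ty ⟦ γ ⟧} {a : Tm ⟦ γ ⟧ A} →
              mkTmGen δ e B x ≡ tmGen γ A a → δ ≡ γ × A ≅ B × a ≅ x
  mkTmGen⁻¹ refl refl = refl , refl , refl

  mkTmGen≢tyGen : ∀ {Γ δ γ} (e : ⟦ δ ⟧ ≡ Γ) {B : Ty Γ} {x : Tm Γ B} {T : Ty ⟦ γ ⟧} →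
                  ¬ mkTmGen δ e B x ≡ tyGen γ T
  mkTmGen≢tyGen refl ()

  mkTyGen≢tmGen : ∀ {Γ δ γ} (e : ⟦ δ ⟧ ≡ Γ) {x : Ty Γ} {A : Ty ⟦ γ ⟧} {a : Tm ⟦ γ ⟧ A} →
                  ¬ mkTyGen δ e x ≡ tmGen γ A a
  mkTyGen≢tmGen refl ()

  module _ (n : ℕ) (j : J n) (δ : Ctx) (e : ⟦ δ ⟧ ≡ φ.ob n (cellOb (cell n j))) where
    private
      g : Label
      g = n , j , δ , e

      HFill : ∀ c → Fill (φ n) c → Raw (len (H.ob (φ.ob n (cellOb c))))
      HFill c x = rawFill (H ∘M φ n) c (mapFill H (φ n) c x)

      -- `H-gen` speaks of the decomposition chosen by `H`, the label `g` of an arbitrary one.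
      -- Decompositions are unique by `H⟦ δ ⟧`, so the two labels coincide.
      HFill-gen : HFill (cell n j) (genC n j) ≅ gen g (ids {len δ})
      HFill-gen = Het.trans (≡-to-≅ (proj₂ (H-gen n j)))
        (gen-label e _ (trans (cong H.ob (sym e)) H⟦ δ ⟧))

    rawTy-gen : ∀ {γ T} → sig g ≡ tyGen γ T → rawTy {γ} T ≅ gen g (ids {len γ})
    rawTy-gen = aux (cell n j) (genC n j) e HFill-gen
      where
      aux : ∀ c (x : Fill (φ n) c) (e : ⟦ δ ⟧ ≡ φ.ob n (cellOb c)) →
            HFill c x ≅ gen g (ids {len δ}) →
            ∀ {γ T} → sigOf n c x δ e ≡ tyGen γ T → rawTy {γ} T ≅ gen g (ids {len γ})
      aux (tyCell Γ) x e l {γ} {T} s with mkTyGen⁻¹ e s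
      ... | refl , T≅x = Het.trans (castR-≅ H⟦ γ ⟧ (TyW.raw (H.ty T)))
        (Het.trans (rawTy-≅ (cong H.ob e) (HC.ty-cong e T≅x)) l)
      aux (tmCell Γ A) x e l s = ⊥-elim (mkTmGen≢tyGen e s)

    rawTm-gen : ∀ {γ A a} → sig g ≡ tmGen γ A a → rawTm {γ} (A , a) ≅ gen g (ids {len γ})
    rawTm-gen = aux (cell n j) (genC n j) e HFill-gen
      where
      aux : ∀ c (x : Fill (φ n) c) (e : ⟦ δ ⟧ ≡ φ.ob n (cellOb c)) →
            HFill c x ≅ gen g (ids {len δ}) →
            ∀ {γ A a} → sigOf n c x δ e ≡ tmGen γ A a → rawTm {γ} (A , a) ≅ gen g (ids {len γ})
      aux (tyCell Γ) x e l s = ⊥-elim (mkTyGen≢tmGen e s)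
      aux (tmCell Γ B) x e l {γ} {A} {a} s with mkTmGen⁻¹ e s
      ... | refl , A≅B , a≅x = Het.trans (castR-≅ H⟦ γ ⟧ (TmW.raw (H.tm a)))
        (Het.trans (raw-≅ (cong H.ob e) (HC.ty-cong e A≅B) (HC.tm-cong e A≅B a≅x)) l)

  []-unique : ∀ {n} (rs : Raws n 0) → rs ≡ []
  []-unique [] = refl

  -- `gen` accepts tuples of any length; the arity of a generator is recovered from typing.
  wfS-len : ∀ {γ} δ {m} (rs : Raws (len γ) m) → WfS γ rs δ → m ≡ len δ
  wfS-len ∙       []       w = refl
  wfS-len (δ ▷ A) (rs ▸ r) w = cong suc (wfS-len δ rs (proj₁ w))

  mutual
    -- The other half of the isomorphism: `P` is injective. An applied generator denotes `t [ σ ]p`,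
    -- `H` commutes with the substitution, and the raw form of `t` is the generator applied to the
    -- identity. Equality in `C` thereby becomes syntactic equality.
    rawTm-unique : ∀ {γ s} r → HasTm γ r s → r ≡ rawTm s
    rawTm-unique {γ} (var i) (has w refl) = sym (rawTm-vars γ i)
    rawTm-unique {γ} {s} (gen g@(n , j , δ' , e) rs) h with genTm h
    ... | mk {δ} t sg {σ} hs refl with wfS-len δ rs (wfS hs)
    ... | refl = sym (trans (rawTm-[] {δ} {γ} t σ)
      (trans (cong (_[ rawS {γ} {δ} σ ]) (≅-to-≡ (rawTm-gen n j δ' e sg)))
             (cong (gen g) (trans (ids-⊙ _) (sym (rawS-unique {γ} {δ} rs hs))))))

    rawS-unique : ∀ {γ δ σ} (rs : Raws (len γ) (len δ)) → HasS γ δ rs σ → rs ≡ rawS {γ} {δ} σ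
    rawS-unique {δ = ∙}     []       h = sym ([]-unique _)
    rawS-unique {γ} {δ ▷ A} {σ} (rs ▸ r) h = trans
      (cong₂ _▸_
        (trans (rawS-unique {γ} {δ} rs (hasS-tail h))
               (trans (rawS-∘ {δ ▷ A} {δ} {γ} p σ)
                      (cong (_⊙ rawS {γ} {δ ▷ A} σ) (rawS-p A))))
        (trans (rawTm-unique r (hasS-head h))
               (trans (rawTm-[] {δ ▷ A} {γ} (qq A) σ)
                      (cong (_[ rawS {γ} {δ ▷ A} σ ]) (rawTm-qq A)))))
      (wk-⊙-▸ (rawS {γ} {δ ▷ A} σ))

  rawTy-unique : ∀ {γ A} r → HasTy γ r A → r ≡ rawTy {γ} A
  rawTy-unique {γ} (gen g@(n , j , δ' , e) rs) h with genTy h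
  ... | mk {δ} T sg {σ} hs refl with wfS-len δ rs (wfS hs)
  ... | refl = sym (trans (rawTy-[] {δ} {γ} T σ)
      (trans (cong (_[ rawS {γ} {δ} σ ]) (≅-to-≡ (rawTy-gen n j δ' e sg)))
             (cong (gen g) (trans (ids-⊙ _) (sym (rawS-unique {γ} {δ} rs hs))))))

  ctxOf : ∀ Γ → Σ Ctx λ γ → ⟦ γ ⟧ ≡ Γ
  ctxOf Γ = H.ob Γ , PH.ob≐ Γ

-- Occurrence of variables, the occurs check, split monos and rigid variables.

module RawFacts (G : Set) where
  open RawSyntax G

  mutual
    -- The predicate `X` will be a single variable when that variable is eliminated, and the set of
    -- rigid variables when an expression is moved out of their scope.
    FreeR : ∀ {n} → (Fin n → Set) → Raw n → Set
    FreeR X (var i)    = ¬ X i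
    FreeR X (gen g rs) = FreeS X rs
    FreeR X junk       = ⊤

    FreeS : ∀ {n m} → (Fin n → Set) → Raws n m → Set
    FreeS X []       = ⊤
    FreeS X (rs ▸ r) = FreeS X rs × FreeR X r

  mutual
    OccR : ∀ {n} → Fin n → Raw n → Set
    OccR i (var j)    = j ≡ i
    OccR i (gen g rs) = OccS i rs
    OccR i junk       = ⊥

    OccS : ∀ {n m} → Fin n → Raws n m → Set
    OccS i []       = ⊥
    OccS i (rs ▸ r) = OccS i rs ⊎ OccR i r

  mutual
    occR? : ∀ {n} (i : Fin n) r → OccR i r ⊎ FreeR (_≡ i) r
    occR? i (var j) with j ≟ i
    ... | yes e = inj₁ e
    ... | no ne = inj₂ ne
    occR? i (gen g rs) = occS? i rs
    occR? i junk       = inj₂ tt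

    occS? : ∀ {n m} (i : Fin n) (rs : Raws n m) → OccS i rs ⊎ FreeS (_≡ i) rs
    occS? i [] = inj₂ tt
    occS? i (rs ▸ r) with occS? i rs | occR? i r
    ... | inj₁ o | _      = inj₁ (inj₁ o)
    ... | inj₂ _ | inj₁ o = inj₁ (inj₂ o)
    ... | inj₂ f | inj₂ g = inj₂ (f , g)

  mutual
    occR-free : ∀ {n} {i : Fin n} r → OccR i r → ¬ FreeR (_≡ i) r
    occR-free (var j)    e f = f e
    occR-free (gen g rs) o f = occS-free rs o f

    occS-free : ∀ {n m} {i : Fin n} (rs : Raws n m) → OccS i rs → ¬ FreeS (_≡ i) rs
    occS-free (rs ▸ r) (inj₁ o) (f , g) = occS-free rs o f
    occS-free (rs ▸ r) (inj₂ o) (f , g) = occR-free r o g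

  mutual
    sizeR : ∀ {n} → Raw n → ℕ
    sizeR (var i)    = 0
    sizeR (gen g rs) = suc (sizeS rs)
    sizeR junk       = 0

    sizeS : ∀ {n m} → Raws n m → ℕ
    sizeS []       = 0
    sizeS (rs ▸ r) = sizeS rs + sizeR r

  mutual
    occR-size : ∀ {n m} {i : Fin n} r (s : Raws m n) → OccR i r →
                sizeR (lookup s i) ≤ sizeR (r [ s ])
    occR-size (var j)    s refl = ≤-refl
    occR-size (gen g rs) s o    = <⇒≤ (s≤s (occS-size rs s o))

    occS-size : ∀ {n m k} {i : Fin n} (rs : Raws n k) (s : Raws m n) → OccS i rs →
                sizeR (lookup s i) ≤ sizeS (rs ⊙ s)
    occS-size (rs ▸ r) s (inj₁ o) = ≤-trans (occS-size rs s o) (m≤m+n _ _)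
    occS-size (rs ▸ r) s (inj₂ o) = ≤-trans (occR-size r s o) (m≤n+m _ _)

  -- Size counts generators. The image of an occurring variable is at most as large as the
  -- substituted arguments, and the head generator adds one.
  occurs-check : ∀ {n m k} {i : Fin n} {g} (rs : Raws n k) (s : Raws m n) → OccS i rs →
                 ¬ lookup s i ≡ gen g rs [ s ]
  occurs-check rs s o e = <-irrefl (cong sizeR e) (s≤s (occS-size rs s o))

  module _ {n m} {X : Fin n → Set} {Y : Fin m → Set} (s : Raws m n) where
    module _ (h : ∀ i → FreeR Y (lookup s i) → ¬ X i) where
      mutual
        freeR-reflect : ∀ r → FreeR Y (r [ s ]) → FreeR X r
        freeR-reflect (var i)    f = h i f
        freeR-reflect (gen g rs) f = freeS-reflect rs f
        freeR-reflect junk       f = tt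

        freeS-reflect : ∀ {k} (rs : Raws n k) → FreeS Y (rs ⊙ s) → FreeS X rs
        freeS-reflect []       f       = tt
        freeS-reflect (rs ▸ r) (f , g) = freeS-reflect rs f , freeR-reflect r g

    module _ (h : ∀ i → ¬ X i → FreeR Y (lookup s i)) where
      mutual
        freeR-sub : ∀ r → FreeR X r → FreeR Y (r [ s ])
        freeR-sub (var i)    f = h i f
        freeR-sub (gen g rs) f = freeS-sub rs f
        freeR-sub junk       f = tt

        freeS-sub : ∀ {k} (rs : Raws n k) → FreeS X rs → FreeS Y (rs ⊙ s)
        freeS-sub []       f       = tt
        freeS-sub (rs ▸ r) (f , g) = freeS-sub rs f , freeR-sub r g

  mutual
    freeR-⊥ : ∀ {n} (r : Raw n) → FreeR (λ _ → ⊥) r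
    freeR-⊥ (var i)    = λ ()
    freeR-⊥ (gen g rs) = freeS-⊥ rs
    freeR-⊥ junk       = tt

    freeS-⊥ : ∀ {n m} (rs : Raws n m) → FreeS (λ _ → ⊥) rs
    freeS-⊥ []       = tt
    freeS-⊥ (rs ▸ r) = freeS-⊥ rs , freeR-⊥ r

  freeR-[] : ∀ {n m} {Y : Fin m → Set} (r : Raw n) (s : Raws m n) →
             (∀ i → FreeR Y (lookup s i)) → FreeR Y (r [ s ])
  freeR-[] r s h = freeR-sub s (λ i _ → h i) r (freeR-⊥ r)

  lookup-wk : ∀ {n} (i : Fin n) → lookup wk i ≡ var (suc i)
  lookup-wk = lookup-tabulate (λ j → var (suc j))

  freeR-wk : ∀ {n} {i : Fin n} r → FreeR (_≡ i) r → FreeR (_≡ suc i) (r [ wk ])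
  freeR-wk {i = i} = freeR-sub wk λ j f →
    subst (FreeR (_≡ suc i)) (sym (lookup-wk j)) λ e → f (suc-injective e)

  freeR-wk⁻¹ : ∀ {n} {i : Fin n} r → FreeR (_≡ suc i) (r [ wk ]) → FreeR (_≡ i) r
  freeR-wk⁻¹ {i = i} = freeR-reflect wk λ j f e →
    subst (FreeR (_≡ suc i)) (lookup-wk j) f (cong suc e)

  -- The retraction is merely a raw tuple, since a well-typed one need not exist. It suffices for
  -- cancellation, which is a statement about raw expressions.
  record SplitMono {n m} (w : Raws n m) : Set where
    constructor split
    field
      {retract} : Raws m n
      retracts  : w ⊙ retract ≡ ids

    cancelR : ∀ r r' → r [ w ] ≡ r' [ w ] → r ≡ r'
    cancelR r r' e = trans (sym (back r)) (trans (cong (_[ retract ]) e) (back r'))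
      where
      back : ∀ r → r [ w ] [ retract ] ≡ r
      back r = trans (sym ([⊙] r w retract)) (trans (cong (r [_]) retracts) ([ids] r))

  open SplitMono public using (cancelR)

  split-ids : ∀ {n} → SplitMono (ids {n})
  split-ids = split (ids-⊙ ids)

  split-wk : ∀ {n} → SplitMono (wk {n})
  split-wk = split (wk-⊙ ids junk)

  split-⊙ : ∀ {n m k} {s : Raws m k} {t : Raws n m} → SplitMono s → SplitMono t → SplitMono (s ⊙ t)
  split-⊙ {s = s} {t} (split {v} e) (split {u} e') = split {retract = u ⊙ v}
    (trans (⊙-assoc s t (u ⊙ v)) (trans (cong (s ⊙_)
      (trans (sym (⊙-assoc t u v)) (trans (cong (_⊙ v) e') (ids-⊙ v)))) e))

  split-liftR : ∀ {n m} {s : Raws n m} → SplitMono s → SplitMono (liftR s)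
  split-liftR {s = s} (split {v} e) = split (trans (liftR-⊙ s v) (trans (cong liftR e) liftR-ids))

  -- Ext k n n': n' variables arise from n variables by adjoining k rigid ones on the right.
  data Ext : ℕ → ℕ → ℕ → Set where
    done : ∀ {n} → Ext zero n n
    step : ∀ {k n n'} → Ext k (suc n) n' → Ext (suc k) n n'

  ext-unique : ∀ {k n n' n''} (a : Ext k n n') (b : Ext k n n'') →
               _≡_ {A = Σ ℕ (Ext k n)} (n' , a) (n'' , b)
  ext-unique done     done     = refl
  ext-unique (step a) (step b) with ext-unique a b
  ... | refl = refl

  liftE : ∀ {k n n' m m'} → Ext k n n' → Ext k m m' → Raws m n → Raws m' n'
  liftE done     done     s = s
  liftE (step a) (step b) s = liftE a b (liftR s)

  wkE : ∀ {k n n'} → Ext k n n' → Raws n' n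
  wkE done     = ids
  wkE (step a) = wk ⊙ wkE a

  flex : ∀ {k n n'} → Ext k n n' → Fin n → Fin n'
  flex done     i = i
  flex (step a) i = flex a (suc i)

  -- Rigid variables are numbered from the outermost one: the first `step` adjoins a variable that
  -- the later steps weaken.
  rigid : ∀ {k n n'} → Ext k n n' → Fin k → Fin n'
  rigid (step a) zero    = flex a zero
  rigid (step a) (suc j) = rigid a j

  data View {k n n'} (a : Ext k n n') : Fin n' → Set where
    isFlex  : ∀ i → View a (flex a i)
    isRigid : ∀ j → View a (rigid a j)

  view : ∀ {k n n'} (a : Ext k n n') i → View a i
  view done i = isFlex i
  view (step a) i with view a i
  ... | isFlex zero    = isRigid zero
  ... | isFlex (suc i) = isFlex i
  ... | isRigid j      = isRigid (suc j)

  liftE-⊙ : ∀ {k l l' m m' n n'} (a : Ext k n n') (b : Ext k m m') (c : Ext k l l')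
            (s : Raws m n) (t : Raws l m) → liftE a b s ⊙ liftE b c t ≡ liftE a c (s ⊙ t)
  liftE-⊙ done     done     done     s t = refl
  liftE-⊙ (step a) (step b) (step c) s t =
    trans (liftE-⊙ a b c (liftR s) (liftR t)) (cong (liftE a c) (liftR-⊙ s t))

  wkE-liftE : ∀ {k m m' n n'} (a : Ext k n n') (b : Ext k m m') (s : Raws m n) →
              wkE a ⊙ liftE a b s ≡ s ⊙ wkE b
  wkE-liftE done     done     s = trans (ids-⊙ s) (sym (⊙-ids s))
  wkE-liftE (step a) (step b) s = trans (⊙-assoc wk (wkE a) _)
    (trans (cong (wk ⊙_) (wkE-liftE a b (liftR s)))
    (trans (sym (⊙-assoc wk (liftR s) (wkE b)))
    (trans (cong (_⊙ wkE b) (wk-⊙-liftR s)) (⊙-assoc s wk (wkE b)))))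

  split-wkE : ∀ {k n n'} (a : Ext k n n') → SplitMono (wkE a)
  split-wkE done     = split-ids
  split-wkE (step a) = split-⊙ split-wk (split-wkE a)

  lookup-wkE : ∀ {k n n'} (a : Ext k n n') i → lookup (wkE a) i ≡ var (flex a i)
  lookup-wkE done     i = lookup-tabulate var i
  lookup-wkE (step a) i = trans (lookup-⊙ wk (wkE a) i)
    (trans (cong (_[ wkE a ]) (lookup-wk i)) (lookup-wkE a (suc i)))

  lookup-liftE-flex : ∀ {k m m' n n'} (a : Ext k n n') (b : Ext k m m') (s : Raws m n) i →
                      lookup (liftE a b s) (flex a i) ≡ lookup s i [ wkE b ]
  lookup-liftE-flex a b s i = trans (cong (_[ liftE a b s ]) (sym (lookup-wkE a i)))
    (trans (sym (lookup-⊙ (wkE a) (liftE a b s) i))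
    (trans (cong (λ u → lookup u i) (wkE-liftE a b s)) (lookup-⊙ s (wkE b) i)))

  lookup-liftE-rigid : ∀ {k m m' n n'} (a : Ext k n n') (b : Ext k m m') (s : Raws m n) j →
                       lookup (liftE a b s) (rigid a j) ≡ var (rigid b j)
  lookup-liftE-rigid (step a) (step b) s zero =
    trans (lookup-liftE-flex a b (liftR s) zero) (lookup-wkE b zero)
  lookup-liftE-rigid (step a) (step b) s (suc j) = lookup-liftE-rigid a b (liftR s) j

  flex-injective : ∀ {k n n'} (a : Ext k n n') {i i'} → flex a i ≡ flex a i' → i ≡ i'
  flex-injective done     e = e
  flex-injective (step a) e = suc-injective (flex-injective a e)

  flex≢rigid : ∀ {k n n'} (a : Ext k n n') i j → ¬ flex a i ≡ rigid a j
  flex≢rigid (step a) i zero    e = case flex-injective a e of λ ()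
  flex≢rigid (step a) i (suc j) e = flex≢rigid a (suc i) j e

  rigid-injective : ∀ {k n n'} (a : Ext k n n') {j j'} → rigid a j ≡ rigid a j' → j ≡ j'
  rigid-injective (step a) {zero}  {zero}   e = refl
  rigid-injective (step a) {zero}  {suc j'} e = ⊥-elim (flex≢rigid a zero j' e)
  rigid-injective (step a) {suc j} {zero}   e = ⊥-elim (flex≢rigid a zero j (sym e))
  rigid-injective (step a) {suc j} {suc j'} e = cong suc (rigid-injective a e)

  IsRigid : ∀ {k n n'} → Ext k n n' → Fin n' → Set
  IsRigid a i = Σ _ λ j → i ≡ rigid a j

  freeR-wkE : ∀ {k n n'} (a : Ext k n n') r → FreeR (IsRigid a) (r [ wkE a ])
  freeR-wkE a r = freeR-[] r (wkE a) λ i →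
    subst (FreeR (IsRigid a)) (sym (lookup-wkE a i)) λ { (j , e) → flex≢rigid a i j e }

  -- A lifted substitution fixes the rigid variables, so one that occurs before substitution still
  -- occurs after it.
  freeR-liftE⁻¹ : ∀ {k m m' n n'} (a : Ext k n n') (b : Ext k m m') (s : Raws m n) r →
                  FreeR (IsRigid b) (r [ liftE a b s ]) → FreeR (IsRigid a) r
  freeR-liftE⁻¹ a b s = freeR-reflect (liftE a b s) λ { _ f (j , refl) →
    subst (FreeR (IsRigid b)) (lookup-liftE-rigid a b s j) f (j , refl) }

  var-injective : ∀ {n} {i j : Fin n} → Raw.var i ≡ var j → i ≡ j
  var-injective refl = refl

  gen-injective : ∀ {n g g' m m'} {rs : Raws n m} {rs' : Raws n m'} → gen g rs ≡ gen g' rs' →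
                  g ≡ g' × m ≡ m' × rs ≅ rs'
  gen-injective refl = refl , refl , refl

-- Strengthening, and the part of a context independent of a variable.

module Solving (C : CwF) (cellular : IsICellular C) where
  open CwF C
  open Representation C cellular
  open RawFacts Label

  record Tmᴿ (γ : Ctx) (r : Raw (len γ)) (A : Ty ⟦ γ ⟧) : Set where
    constructor ofTm
    field
      {tm}   : Tm ⟦ γ ⟧ A
      tm-has : HasTm γ r (A , tm)

  record Subᴿ (θ γ : Ctx) {m : ℕ} (rs : Raws (len θ) m) : Set where
    constructor ofS
    field
      {hom}   : Hom ⟦ θ ⟧ ⟦ γ ⟧
      hom-has : HasS θ γ rs hom

  open Tmᴿ public
  open Subᴿ public

  vty : ∀ γ → Fin (len γ) → Ty ⟦ γ ⟧
  vty γ i = proj₁ (vars γ i)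

  tmᴿ-[] : ∀ {γ θ r A rs} → Tmᴿ γ r A → (s : Subᴿ θ γ rs) → Tmᴿ θ (r [ rs ]) (A [ hom s ]T)
  tmᴿ-[] (ofTm h) (ofS hs) = ofTm (hasTm-sub h hs)

  tmᴿ-≡ : ∀ {γ r A B} → A ≡ B → Tmᴿ γ r A → Tmᴿ γ r B
  tmᴿ-≡ refl t = t

  tmᴿ-raw : ∀ {γ r r' A} → r ≡ r' → Tmᴿ γ r A → Tmᴿ γ r' A
  tmᴿ-raw refl t = t

  tmᴿ-det : ∀ {γ r A B} → Tmᴿ γ r A → Tmᴿ γ r B → A ≡ B
  tmᴿ-det (ofTm h) (ofTm h') = cong proj₁ (hasTm-det h h')

  tmᴿ-var : ∀ {γ} i → Tmᴿ γ (var i) (vty γ i)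
  tmᴿ-var i = ofTm (has tt refl)

  subᴿ-⊙ : ∀ {γ θ δ m} {rs : Raws (len γ) m} {ss} → Subᴿ γ δ rs → Subᴿ θ γ ss → Subᴿ θ δ (rs ⊙ ss)
  subᴿ-⊙ (ofS h) (ofS h') = ofS (hasS-∘ h h')

  hom-det : ∀ {γ δ m} {rs rs' : Raws (len γ) m} (s : Subᴿ γ δ rs) (s' : Subᴿ γ δ rs') →
            rs ≡ rs' → hom s ≡ hom s'
  hom-det (ofS h) (ofS h') refl = hasS-det h h'

  infixl 5 _,ᴿ_
  _,ᴿ_ : ∀ {γ δ m A} {rs : Raws (len γ) m} {r} (s : Subᴿ γ δ rs) → Tmᴿ γ r (A [ hom s ]T) →
         Subᴿ γ (δ ▷ A) (rs ▸ r)
  _,ᴿ_ {A = A} (ofS {σ} h) (ofTm {t} h') = ofS {hom = ⟨ σ , t ⟩}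
    (hasS-▸ (hasS-≡ (sym (p∘⟨⟩ σ t)) h) (hasTm-≡ (sym (qq-ext σ (_ , t) refl)) h'))

  subᴿ-ids : ∀ {γ} → Subᴿ γ γ ids
  subᴿ-ids {γ} = ofS (hasS-ids {γ})

  subᴿ-wk : ∀ {γ A} → Subᴿ (γ ▷ A) γ wk
  subᴿ-wk {γ} {A} = ofS (hasS-wk {γ} {A})

  hom-⊙ : ∀ {γ θ δ m} {rs : Raws (len γ) m} {ss} (s : Subᴿ γ δ rs) (u : Subᴿ θ γ ss) {rs'}
          (v : Subᴿ θ δ rs') → rs ⊙ ss ≡ rs' → (A : Ty ⟦ δ ⟧) →
          A [ hom s ]T [ hom u ]T ≡ A [ hom v ]T
  hom-⊙ s u v e A = trans (sym ([∘]T A (hom s) (hom u)))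
    (cong (A [_]T) (hasS-det (hasS-∘ (hom-has s) (hom-has u)) (subst (λ x → HasS _ _ x _) (sym e) (hom-has v))))

  tailᴿ : ∀ {γ δ m A} {rs : Raws (len γ) m} {r} → Subᴿ γ (δ ▷ A) (rs ▸ r) → Subᴿ γ δ rs
  tailᴿ (ofS h) = ofS (hasS-tail h)

  headᴿ : ∀ {γ δ m A} {rs : Raws (len γ) m} {r} (s : Subᴿ γ (δ ▷ A) (rs ▸ r)) →
          Tmᴿ γ r (A [ hom (tailᴿ s) ]T)
  headᴿ {A = A} (ofS {ρ} h) = tmᴿ-≡ (sym ([∘]T A p ρ)) (ofTm (hasS-head h))

  liftᴿ : ∀ {γ θ} {rs : Raws (len θ) (len γ)} (s : Subᴿ θ γ rs) (A : Ty ⟦ γ ⟧) →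
          Subᴿ (θ ▷ A [ hom s ]T) (γ ▷ A) (liftR rs)
  liftᴿ s A = subᴿ-⊙ s subᴿ-wk ,ᴿ
    tmᴿ-≡ (hom-⊙ s subᴿ-wk (subᴿ-⊙ s subᴿ-wk) refl A) (tmᴿ-var zero)

  rawTy-sub : ∀ {γ θ rs} (s : Subᴿ θ γ rs) (A : Ty ⟦ γ ⟧) →
              rawTy {θ} (A [ hom s ]T) ≡ rawTy {γ} A [ rs ]
  rawTy-sub s A = sym (rawTy-unique _ (hasTy-sub (rawTy-has A) (hom-has s)))

  rawTy-inj : ∀ {γ} {A B : Ty ⟦ γ ⟧} → rawTy {γ} A ≡ rawTy {γ} B → A ≡ B
  rawTy-inj {γ} {A} {B} e =
    hasTy-det (rawTy-has A) (subst (λ r → HasTy γ r B) (sym e) (rawTy-has B))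

  -- Strengthening along a split mono w.  An expression avoiding X comes from I because the type of
  -- each of its variables also avoids X: types are generators applied to substitutions, so every
  -- variable a type mentions is an argument of any term having that type.
  module Strengthening {ψ I : Ctx} {X : Fin (len ψ) → Set} {w} (hw : Subᴿ ψ I w)
    (mono : SplitMono w) (w-free : ∀ i → FreeR X (lookup w i))
    (hit : ∀ y → ¬ X y → FreeR X (rawTy {ψ} (vty ψ y)) → Σ (Fin (len I)) λ y' → lookup w y' ≡ var y)
    where

    -- Determinacy of typing compares the type of a strengthened expression with the expected one
    -- only after weakening along `w`. Types are determined by their raw forms, on which `w` can be
    -- cancelled.
    cancelT : {B B' : Ty ⟦ I ⟧} → B [ hom hw ]T ≡ B' [ hom hw ]T → B ≡ B'
    cancelT {B} {B'} e = rawTy-inj (cancelR mono _ _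
      (trans (sym (rawTy-sub hw B)) (trans (cong (rawTy {ψ}) e) (rawTy-sub hw B'))))

    mutual
      strengthenTm : ∀ r {B} → Tmᴿ ψ r (B [ hom hw ]T) → FreeR X r →
                     Σ (Raw (len I)) λ r' → Tmᴿ I r' B × r ≡ r' [ w ]
      strengthenTm (var y) {B} t f = var y' , tmᴿ-≡ (cancelT eB) (tmᴿ-var y') , sym e
        where
        free : FreeR X (rawTy {ψ} (vty ψ y))
        -- The variable `y` has type `B [ hom hw ]T`, whose raw form is substituted along `w` and
        -- hence avoids `X` whatever `B` is.
        free = subst (FreeR X)
          (sym (trans (cong (rawTy {ψ}) (tmᴿ-det (tmᴿ-var y) t)) (rawTy-sub hw B)))
          (freeR-[] (rawTy {I} B) w w-free)
        y' = proj₁ (hit y f free)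
        e  = proj₂ (hit y f free)
        eB : vty I y' [ hom hw ]T ≡ B [ hom hw ]T
        eB = tmᴿ-det (tmᴿ-raw e (tmᴿ-[] (tmᴿ-var y') hw)) t
      strengthenTm (gen g rs) {B} t f with genTm (tm-has t)
      ... | mk (A , a) sg hs eq with strengthenS rs (ofS hs) f
      ... | rs' , s' , e = gen g rs' , tmᴿ-≡ (cancelT eB) t' , cong (gen g) e
        where
        t' : Tmᴿ I (gen g rs') (A [ hom s' ]T)
        t' = ofTm (hasTm-gen sg (hom-has s'))
        eB = tmᴿ-det (tmᴿ-raw (cong (gen g) (sym e)) (tmᴿ-[] t' hw)) t
      strengthenTm junk (ofTm (has () _)) f

      strengthenS : ∀ {m} (rs : Raws (len ψ) m) {δ} → Subᴿ ψ δ rs → FreeS X rs →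
                    Σ (Raws (len I) m) λ rs' → Subᴿ I δ rs' × rs ≡ rs' ⊙ w
      strengthenS []       {∙}     s f = [] , ofS (hasS-ε ε) , refl
      strengthenS []       {δ ▷ A} (ofS (has () _)) f
      strengthenS (rs ▸ r) {∙}     (ofS (has () _)) f
      strengthenS (rs ▸ r) {δ ▷ A} s (f , f') with strengthenS rs (tailᴿ s) f
      ... | rs' , s' , e
        -- With the prefix strengthened to `s'`, the type of the last component is the weakening of
        -- `A [ hom s' ]T`, as the recursive call requires.
        with strengthenTm r (tmᴿ-≡ (sym (hom-⊙ s' hw (tailᴿ s) (sym e) A)) (headᴿ s)) f'
      ... | r' , t' , e' = rs' ▸ r' , s' ,ᴿ t' , cong₂ _▸_ e e'

    strengthenTy : ∀ r {B} → HasTy ψ r B → FreeR X r → Σ (Ty ⟦ I ⟧) λ B' → B ≡ B' [ hom hw ]T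
    strengthenTy (gen g rs) h f with genTy h
    ... | mk T sg hs refl with strengthenS rs (ofS hs) f
    ... | rs' , s' , e = T [ hom s' ]T , sym (hom-⊙ s' hw (ofS hs) (sym e) T)

  -- Pullbacks of (w , var i) : γ → I ▷ A along (τ , r) : ω → I ▷ A, where projecting the pullback
  -- to ω forgets k variables.
  record Pullback (γ : Ctx) (i : Fin (len γ)) {I : Ctx} (w : Raws (len γ) (len I)) (k : ℕ)
                  (ω : Ctx) (τ : Raws (len ω) (len I)) (r : Raw (len ω)) : Set where
    field
      {π}   : Ctx
      len-π : len π ≡ k + len ω
      {π₁}  : Raws (len π) (len γ)
      {π₂}  : Raws (len π) (len ω)
      h₁    : Subᴿ π γ π₁
      h₂    : Subᴿ π ω π₂
      comm  : w ⊙ π₁ ≡ τ ⊙ π₂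
      commᵢ : lookup π₁ i ≡ r [ π₂ ]
      univ  : ∀ {θ u v} → Subᴿ θ γ u → Subᴿ θ ω v → w ⊙ u ≡ τ ⊙ v → lookup u i ≡ r [ v ] →
              Σ (Raws (len θ) (len π)) λ h → Subᴿ θ π h × π₁ ⊙ h ≡ u × π₂ ⊙ h ≡ v
      joint : ∀ {n} (h h' : Raws n (len π)) → π₁ ⊙ h ≡ π₁ ⊙ h' → π₂ ⊙ h ≡ π₂ ⊙ h' → h ≡ h'

  -- I is the part of γ that does not depend on the variable i, and w the projection onto it.  The
  -- variables depending on i form a telescope over I ▷ A, hence the pullbacks.
  record Independent (γ : Ctx) (i : Fin (len γ)) : Set where
    field
      I      : Ctx
      {w}    : Raws (len γ) (len I)
      hw     : Subᴿ γ I w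
      A      : Ty ⟦ I ⟧
      vty≡   : vty γ i ≡ A [ hom hw ]T
      mono   : SplitMono w
      w-free : ∀ j → FreeR (_≡ i) (lookup w j)
      hit    : ∀ y → ¬ y ≡ i → FreeR (_≡ i) (rawTy {γ} (vty γ y)) →
               Σ (Fin (len I)) λ y' → lookup w y' ≡ var y
      k      : ℕ
      len≡   : len γ ≡ suc (k + len I)
      pullback : ∀ {ω τ r} (hτ : Subᴿ ω I τ) → Tmᴿ ω r (A [ hom hτ ]T) → Pullback γ i w k ω τ r

  rawTy-wk : ∀ {γ B} (A : Ty ⟦ γ ⟧) → rawTy {γ ▷ B} (A [ p ]T) ≡ rawTy {γ} A [ wk ]
  rawTy-wk {γ} {B} = rawTy-sub (subᴿ-wk {γ} {B})

  -- Here `wk ▸ var zero` is the identity, so the pullback is `ω` itself and no variable is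
  -- forgotten.
  independent-last : ∀ γ A → Independent (γ ▷ A) zero
  independent-last γ A = record
    { I = γ ; hw = subᴿ-wk ; A = A ; vty≡ = refl ; mono = split-wk
    ; w-free = λ j → subst (FreeR (_≡ zero)) (sym (lookup-wk j)) λ ()
    ; hit = λ { zero ne f → ⊥-elim (ne refl) ; (suc y) ne f → y , lookup-wk y }
    ; k = 0 ; len≡ = refl
    ; pullback = λ {ω} {τ} {r} hτ hr → record
        { len-π = refl ; h₁ = hτ ,ᴿ hr ; h₂ = subᴿ-ids
        ; comm = trans (wk-⊙ τ r) (sym (⊙-ids τ)) ; commᵢ = sym ([ids] r)
        ; univ = λ { {u = u ▸ x} {v} hu hv e e' →
            v , hv , cong₂ _▸_ (trans (sym e) (wk-⊙ u x)) (sym e') , ids-⊙ v }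
        ; joint = λ h h' _ e → trans (sym (ids-⊙ h)) (trans e (ids-⊙ h')) } }

  module _ {γ : Ctx} {i : Fin (len γ)} (D : Independent γ i) (B : Ty ⟦ γ ⟧) where
    private
      module D = Independent D

    -- The new variable depends on `i` and stays outside `I`. The pullback follows by adjoining `B`
    -- substituted along `π₁`, so its projection to `ω` forgets one more variable.
    independent-dependent : OccR i (rawTy {γ} B) → Independent (γ ▷ B) (suc i)
    independent-dependent occ = record
      { I = D.I ; hw = hw ; A = D.A
      ; vty≡ = trans (cong (_[ p ]T) D.vty≡) (hom-⊙ D.hw subᴿ-wk hw refl D.A)
      ; mono = split-⊙ D.mono split-wk
      ; w-free = λ j → subst (FreeR (_≡ suc i)) (sym (lookup-⊙ D.w wk j))
                             (freeR-wk (lookup D.w j) (D.w-free j))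
      ; hit = hit
      ; k = suc D.k ; len≡ = cong suc D.len≡
      ; pullback = pullback }
      where
      hw = subᴿ-⊙ D.hw (subᴿ-wk {γ} {B})

      hit : ∀ y → ¬ y ≡ suc i → FreeR (_≡ suc i) (rawTy {γ ▷ B} (vty (γ ▷ B) y)) →
            Σ (Fin (len D.I)) λ y' → lookup (D.w ⊙ wk) y' ≡ var y
      hit zero ne f = ⊥-elim (occR-free (rawTy {γ} B) occ
        (freeR-wk⁻¹ (rawTy {γ} B) (subst (FreeR _) (rawTy-wk B) f)))
      hit (suc y) ne f =
        proj₁ h , trans (lookup-⊙ D.w wk (proj₁ h)) (trans (cong (_[ wk ]) (proj₂ h)) (lookup-wk y))
        where h = D.hit y (λ e → ne (cong suc e))
                    (freeR-wk⁻¹ (rawTy {γ} (vty γ y)) (subst (FreeR _) (rawTy-wk (vty γ y)) f))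

      pullback : ∀ {ω τ r} (hτ : Subᴿ ω D.I τ) → Tmᴿ ω r (D.A [ hom hτ ]T) →
                 Pullback (γ ▷ B) (suc i) (D.w ⊙ wk) (suc D.k) ω τ r
      pullback {ω} {τ} {r} hτ hr = record
        { π = π' ; len-π = cong suc P.len-π
        ; h₁ = liftᴿ P.h₁ B ; h₂ = subᴿ-⊙ P.h₂ subᴿ-wk
        ; comm = trans (⊙-assoc D.w wk _) (trans (cong (D.w ⊙_) (wk-⊙-liftR P.π₁))
            (trans (sym (⊙-assoc D.w P.π₁ wk)) (trans (cong (_⊙ wk) P.comm) (⊙-assoc τ P.π₂ wk))))
        ; commᵢ = trans (lookup-⊙ P.π₁ wk i) (trans (cong (_[ wk ]) P.commᵢ) (sym ([⊙] r P.π₂ wk)))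
        ; univ = univ
        ; joint = joint }
        where
        module P = Pullback (D.pullback hτ hr)
        π' = P.π ▷ B [ hom P.h₁ ]T
        univ : ∀ {θ u v} → Subᴿ θ (γ ▷ B) u → Subᴿ θ ω v → (D.w ⊙ wk) ⊙ u ≡ τ ⊙ v →
               lookup u (suc i) ≡ r [ v ] → Σ (Raws (len θ) (len π')) λ h → Subᴿ θ π' h ×
                 liftR P.π₁ ⊙ h ≡ u × (P.π₂ ⊙ wk) ⊙ h ≡ v
        univ {u = u ▸ b} {v} hu hv e e'
          with P.univ (tailᴿ hu) hv
                 (trans (sym (⊙-wk-▸ D.w u b)) e) e'
        ... | h , hh , e₁ , e₂ = h ▸ b ,
          hh ,ᴿ tmᴿ-≡ (sym (hom-⊙ P.h₁ hh (tailᴿ hu) e₁ B)) (headᴿ hu) ,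
          trans (liftR-⊙-▸ P.π₁ h b) (cong (_▸ b) e₁) ,
          trans (⊙-wk-▸ P.π₂ h b) e₂
        joint : ∀ {n} (h h' : Raws n (len π')) → liftR P.π₁ ⊙ h ≡ liftR P.π₁ ⊙ h' →
                (P.π₂ ⊙ wk) ⊙ h ≡ (P.π₂ ⊙ wk) ⊙ h' → h ≡ h'
        joint (h ▸ x) (h' ▸ x') e e' = cong₂ _▸_
          (P.joint h h' (proj₁ eqs)
            (trans (sym (⊙-wk-▸ P.π₂ h x)) (trans e' (⊙-wk-▸ P.π₂ h' x'))))
          (proj₂ eqs)
          where
          eqs = ▸-injective (trans (sym (liftR-⊙-▸ P.π₁ h x)) (trans e (liftR-⊙-▸ P.π₁ h' x')))

    -- Strengthening, applied with the data already built for `γ`, shows that `B` is weakened from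
    -- some `B₀` over `I`. Then `γ ▷ B` is the pullback of `I ▷ B₀` along `w`, and by pasting the
    -- old pullback serves again: the value of the new variable is the component `b` that `ω`
    -- already supplies.
    independent-independent : FreeR (_≡ i) (rawTy {γ} B) → Independent (γ ▷ B) (suc i)
    independent-independent free = record
      { I = D.I ▷ B₀ ; hw = hw' ; A = D.A [ p ]T
      ; vty≡ = trans (cong (_[ p ]T) D.vty≡) (trans (hom-⊙ D.hw subᴿ-wk hw refl D.A)
          (sym (hom-⊙ subᴿ-wk hw' hw (wk-⊙-liftR D.w) D.A)))
      ; mono = split-liftR D.mono
      ; w-free = λ { zero () ; (suc j) → subst (FreeR (_≡ suc i)) (sym (lookup-⊙ D.w wk j))
                                            (freeR-wk (lookup D.w j) (D.w-free j)) }
      ; hit = hit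
      ; k = D.k ; len≡ = cong suc (trans D.len≡ (sym (+-suc D.k (len D.I))))
      ; pullback = pullback }
      where
      module S = Strengthening D.hw D.mono D.w-free D.hit
      B₀ = proj₁ (S.strengthenTy (rawTy {γ} B) (rawTy-has B) free)
      B≡ : B ≡ B₀ [ hom D.hw ]T
      B≡ = proj₂ (S.strengthenTy (rawTy {γ} B) (rawTy-has B) free)

      hw = subᴿ-⊙ D.hw (subᴿ-wk {γ} {B})

      hw' : Subᴿ (γ ▷ B) (D.I ▷ B₀) (liftR D.w)
      hw' = hw ,ᴿ tmᴿ-≡ (trans (cong (_[ p ]T) B≡) (hom-⊙ D.hw subᴿ-wk hw refl B₀)) (tmᴿ-var zero)

      hit : ∀ y → ¬ y ≡ suc i → FreeR (_≡ suc i) (rawTy {γ ▷ B} (vty (γ ▷ B) y)) →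
            Σ (Fin (suc (len D.I))) λ y' → lookup (liftR D.w) y' ≡ var y
      hit zero    ne f = zero , refl
      hit (suc y) ne f = suc (proj₁ h) ,
        trans (lookup-⊙ D.w wk (proj₁ h)) (trans (cong (_[ wk ]) (proj₂ h)) (lookup-wk y))
        where h = D.hit y (λ e → ne (cong suc e))
                    (freeR-wk⁻¹ (rawTy {γ} (vty γ y)) (subst (FreeR _) (rawTy-wk (vty γ y)) f))

      pullback : ∀ {ω τ r} (hτ : Subᴿ ω (D.I ▷ B₀) τ) → Tmᴿ ω r (D.A [ p ]T [ hom hτ ]T) →
                 Pullback (γ ▷ B) (suc i) (liftR D.w) D.k ω τ r
      pullback {ω} {τ ▸ b} {r} hτ hr = record
        { len-π = P.len-π
        ; h₁ = P.h₁ ,ᴿ tmᴿ-≡ eB (tmᴿ-[] (headᴿ hτ) P.h₂)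
        ; h₂ = P.h₂
        ; comm = trans (liftR-⊙-▸ D.w P.π₁ (b [ P.π₂ ])) (cong (_▸ b [ P.π₂ ]) P.comm)
        ; commᵢ = P.commᵢ
        ; univ = univ
        ; joint = λ h h' e → P.joint h h' (proj₁ (▸-injective e)) }
        where
        module P = Pullback (D.pullback (tailᴿ hτ)
          (tmᴿ-≡ (hom-⊙ subᴿ-wk hτ (tailᴿ hτ) (wk-⊙ τ b) D.A) hr))
        eB : B₀ [ hom (tailᴿ hτ) ]T [ hom P.h₂ ]T ≡ B [ hom P.h₁ ]T
        eB = trans (hom-⊙ (tailᴿ hτ) P.h₂ (subᴿ-⊙ D.hw P.h₁) (sym P.comm) B₀)
          (trans (sym (hom-⊙ D.hw P.h₁ (subᴿ-⊙ D.hw P.h₁) refl B₀)) (cong (_[ hom P.h₁ ]T) (sym B≡)))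
        univ : ∀ {θ u v} → Subᴿ θ (γ ▷ B) u → Subᴿ θ ω v → liftR D.w ⊙ u ≡ (τ ▸ b) ⊙ v →
               lookup u (suc i) ≡ r [ v ] → Σ (Raws (len θ) (len P.π)) λ h → Subᴿ θ P.π h ×
                 (P.π₁ ▸ b [ P.π₂ ]) ⊙ h ≡ u × P.π₂ ⊙ h ≡ v
        univ {u = u ▸ x} {v} hu hv e e'
          with ▸-injective (trans (sym (liftR-⊙-▸ D.w u x)) e)
        ... | e₁ , e₂ with P.univ (tailᴿ hu) hv e₁ e'
        ... | h , hh , e₃ , e₄ = h , hh ,
          cong₂ _▸_ e₃ (trans (sym ([⊙] b P.π₂ h)) (trans (cong (b [_]) e₄) (sym e₂))) , e₄

  independent : ∀ γ i → Independent γ i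
  independent (γ ▷ A) zero    = independent-last γ A
  independent (γ ▷ A) (suc i) with occR? i (rawTy {γ} A)
  ... | inj₁ occ  = independent-dependent (independent γ i) A occ
  ... | inj₂ free = independent-independent (independent γ i) A free

-- First-order unification over a context with rigid variables.

module Unification (C : CwF) (cellular : IsICellular C) where
  open CwF C
  open Representation C cellular
  open RawFacts Label
  open Solving C cellular

  data Over (γ : Ctx) : Ctx → ℕ → Set where
    here  : Over γ γ zero
    there : ∀ {A ψ k} → Over (γ ▷ A) ψ k → Over γ ψ (suc k)

  extOf : ∀ {γ ψ k} → Over γ ψ k → Ext k (len γ) (len ψ)
  extOf here      = done
  extOf (there o) = step (extOf o)

  overWk : ∀ {γ ψ k} (o : Over γ ψ k) → Subᴿ ψ γ (wkE (extOf o))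
  overWk here      = subᴿ-ids
  overWk (there o) = subᴿ-⊙ subᴿ-wk (overWk o)

  record Transported {γ ψ k} (o : Over γ ψ k) (θ : Ctx) (ρ : Raws (len θ) (len γ)) : Set where
    constructor transported
    field
      {ψ'} : Ctx
      over : Over θ ψ' k
      sub  : Subᴿ ψ' ψ (liftE (extOf o) (extOf over) ρ)

  transport : ∀ {γ ψ k θ ρ} (o : Over γ ψ k) → Subᴿ θ γ ρ → Transported o θ ρ
  transport here h = transported here h
  transport (there {A} o) h with transport o (liftᴿ h A)
  ... | transported o' s = transported (there o') s

  -- A problem tells which substitutions into n variables solve it, after lifting over k rigid ones.
  Problem : ℕ → ℕ → Set₁
  Problem k n = ∀ {m m'} → Ext k m m' → Raws m n → Set

  module _ (γ : Ctx) {k : ℕ} (U : Problem k (len γ)) where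
    record Unifier : Set where
      constructor unifier
      field
        {θ}     : Ctx
        {ρ}     : Raws (len θ) (len γ)
        h       : Subᴿ θ γ ρ
        {m'}    : ℕ
        b       : Ext k (len θ) m'
        unifies : U b ρ

    -- Only the nontrivial outcome: the identity is the most general unifier when both sides are
    -- syntactically equal, and that case is recorded separately. Uniqueness of factorizations is
    -- expressed by `monic`.
    record MGU : Set where
      field
        {Ω}     : Ctx
        shorter : len Ω < len γ
        {ρ₀}    : Raws (len Ω) (len γ)
        h₀      : Subᴿ Ω γ ρ₀
        unifies : ∀ {m'} (b : Ext k (len Ω) m') → U b ρ₀
        factor  : ∀ {θ ρ m'} → Subᴿ θ γ ρ → (b : Ext k (len θ) m') → U b ρ →
                  Σ (Raws (len θ) (len Ω)) λ τ → Subᴿ θ Ω τ × ρ ≡ ρ₀ ⊙ τ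
        monic   : ∀ {n} (τ τ' : Raws n (len Ω)) → ρ₀ ⊙ τ ≡ ρ₀ ⊙ τ' → τ ≡ τ'

  module _ {γ : Ctx} {k : ℕ} {U V : Problem k (len γ)}
           (f : ∀ {m m'} (b : Ext k m m') ρ → U b ρ → V b ρ)
           (g : ∀ {m m'} (b : Ext k m m') ρ → V b ρ → U b ρ) where
    mapMGU : MGU γ U → MGU γ V
    mapMGU M = record
      { shorter = M.shorter ; h₀ = M.h₀ ; unifies = λ b → f b _ (M.unifies b)
      ; factor = λ h b u → M.factor h b (g b _ u) ; monic = M.monic }
      where module M = MGU M

  mapUnifier : ∀ {γ k} {U V : Problem k (len γ)} → (∀ {m m'} (b : Ext k m m') ρ → U b ρ → V b ρ) →
               Unifier γ U → Unifier γ V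
  mapUnifier f (unifier h b u) = unifier h b (f b _ u)

  EqTm : ∀ {k n n'} → Ext k n n' → Raw n' → Raw n' → Problem k n
  EqTm a r r' b ρ = r [ liftE a b ρ ] ≡ r' [ liftE a b ρ ]

  EqS : ∀ {k n n' l} → Ext k n n' → Raws n' l → Raws n' l → Problem k n
  EqS a rs rs' b ρ = rs ⊙ liftE a b ρ ≡ rs' ⊙ liftE a b ρ

  SolveVar : ∀ {n} k → Fin n → Raw n → Problem k n
  SolveVar k i t b ρ = lookup ρ i ≡ t [ ρ ]

  -- Functoriality of `liftE` turns the equation between last components, for substitutions that
  -- factor through the first solution, into the residual equation over `Ω`.
  composeMGU : ∀ {γ k n'} (a : Ext k (len γ) n') {l} {rs rs' : Raws n' l} {r r' : Raw n'}
               (M : MGU γ (EqS a rs rs')) → let open MGU M in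
               ∀ {n''} (c : Ext k (len Ω) n'') →
               MGU Ω (EqTm c (r [ liftE a c ρ₀ ]) (r' [ liftE a c ρ₀ ])) →
               MGU γ (EqS a (rs ▸ r) (rs' ▸ r'))
  composeMGU {γ} {k} a {rs = rs} {rs'} {r} {r'} M c N = record
    { shorter = <-trans N.shorter M.shorter
    ; h₀ = subᴿ-⊙ M.h₀ N.h₀
    ; unifies = λ b → cong₂ _▸_
        (trans (push b rs N.ρ₀)
          (trans (cong (_⊙ liftE c b N.ρ₀) (M.unifies c)) (sym (push b rs' N.ρ₀))))
        (trans (pushTm b r N.ρ₀) (trans (N.unifies b) (sym (pushTm b r' N.ρ₀))))
    ; factor = factor
    ; monic = λ τ τ' e → N.monic τ τ' (M.monic _ _
        (trans (sym (⊙-assoc M.ρ₀ N.ρ₀ τ)) (trans e (⊙-assoc M.ρ₀ N.ρ₀ τ')))) }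
    where
    module M = MGU M
    module N = MGU N
    push : ∀ {l m m'} (b : Ext k m m') (us : Raws _ l) τ →
           us ⊙ liftE a b (M.ρ₀ ⊙ τ) ≡ (us ⊙ liftE a c M.ρ₀) ⊙ liftE c b τ
    push b us τ = trans (cong (us ⊙_) (sym (liftE-⊙ a c b M.ρ₀ τ))) (sym (⊙-assoc us _ _))
    pushTm : ∀ {m m'} (b : Ext k m m') u τ →
             u [ liftE a b (M.ρ₀ ⊙ τ) ] ≡ u [ liftE a c M.ρ₀ ] [ liftE c b τ ]
    pushTm b u τ = trans (cong (u [_]) (sym (liftE-⊙ a c b M.ρ₀ τ))) ([⊙] u _ _)
    factor : ∀ {θ ρ m'} → Subᴿ θ γ ρ → (b : Ext k (len θ) m') → EqS a (rs ▸ r) (rs' ▸ r') b ρ →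
             Σ (Raws (len θ) (len N.Ω)) λ τ → Subᴿ θ N.Ω τ × ρ ≡ (M.ρ₀ ⊙ N.ρ₀) ⊙ τ
    factor h b u with M.factor h b (proj₁ (▸-injective u))
    ... | τ , hτ , refl
      with N.factor hτ b (trans (sym (pushTm b r τ))
                           (trans (proj₂ (▸-injective u)) (pushTm b r' τ)))
    ... | υ , hυ , refl = υ , hυ , sym (⊙-assoc M.ρ₀ N.ρ₀ υ)

  module _ {γ : Ctx} (k : ℕ) (i : Fin (len γ)) {t : Raw (len γ)} (ht : Tmᴿ γ t (vty γ i)) where
    private
      module D = Independent (independent γ i)
      module S = Strengthening D.hw D.mono D.w-free D.hit

    eliminateVar : FreeR (_≡ i) t → MGU γ (SolveVar k i t)
    eliminateVar free with S.strengthenTm t (tmᴿ-≡ D.vty≡ ht) free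
    ... | t₁ , ht₁ , refl = record
      -- The length of `γ` counts `i`, the `D.k` variables depending on it, and `D.I`. The pullback
      -- over `D.I` retains all but `i`.
      { shorter = ≤-reflexive (trans (cong suc P.len-π) (sym D.len≡))
      ; h₀ = P.h₁
      ; unifies = λ _ → trans P.commᵢ (trans (cong (t₁ [_]) (sym comm)) ([⊙] t₁ D.w P.π₁))
      ; factor = factor
      ; monic = λ τ τ' e → P.joint τ τ' e (trans (π₂-⊙ τ)
          (trans (cong (D.w ⊙_) e) (sym (π₂-⊙ τ')))) }
      where
      -- Taking `ω` to be `D.I` with the identity forces `π₂` to be the composite of `D.w` and `π₁`,
      -- so `P.commᵢ` becomes exactly the equation to be solved.
      module P = Pullback (D.pullback subᴿ-ids (tmᴿ-≡ (sym ([id]T D.A)) ht₁))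
      comm : D.w ⊙ P.π₁ ≡ P.π₂
      comm = trans P.comm (ids-⊙ P.π₂)
      π₂-⊙ : ∀ {n} (τ : Raws n (len P.π)) → P.π₂ ⊙ τ ≡ D.w ⊙ (P.π₁ ⊙ τ)
      π₂-⊙ τ = trans (cong (_⊙ τ) (sym comm)) (⊙-assoc D.w P.π₁ τ)
      factor : ∀ {θ ρ m'} → Subᴿ θ γ ρ → (b : Ext k (len θ) m') → lookup ρ i ≡ t₁ [ D.w ] [ ρ ] →
               Σ (Raws (len θ) (len P.π)) λ τ → Subᴿ θ P.π τ × ρ ≡ P.π₁ ⊙ τ
      factor {ρ = ρ} h b u
        with P.univ h (subᴿ-⊙ D.hw h) (sym (ids-⊙ _)) (trans u (sym ([⊙] t₁ D.w ρ)))
      ... | τ , hτ , e , _ = τ , hτ , sym e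

    solveVar : Unifier γ (SolveVar k i t) → (var i ≡ t) ⊎ MGU γ (SolveVar k i t)
    solveVar U = aux t ht refl
      where
      aux : ∀ u → Tmᴿ γ u (vty γ i) → t ≡ u → (var i ≡ t) ⊎ MGU γ (SolveVar k i t)
      aux (var j) h refl with j ≟ i
      ... | yes refl = inj₁ refl
      ... | no ne    = inj₂ (eliminateVar ne)
      aux (gen g rs) h refl with occS? i rs
      ... | inj₁ occ  = ⊥-elim (occurs-check rs (Unifier.ρ U) occ (Unifier.unifies U))
      ... | inj₂ free = inj₂ (eliminateVar free)
      aux junk (ofTm (has () _)) e

  module _ {γ ψ k} (o : Over γ ψ k) where
    private
      a = extOf o

    weakened : ∀ {m m' i t₀} (b : Ext k m m') (ρ : Raws m (len γ)) →
               SolveVar k i t₀ b ρ → EqTm a (var (flex a i)) (t₀ [ wkE a ]) b ρ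
    weakened {i = i} {t₀} b ρ u = trans (lookup-liftE-flex a b ρ i) (trans (cong (_[ wkE b ]) u)
      (trans (sym ([⊙] t₀ ρ (wkE b))) (trans (cong (t₀ [_]) (sym (wkE-liftE a b ρ)))
        ([⊙] t₀ (wkE a) (liftE a b ρ)))))

    weakened⁻¹ : ∀ {m m' i t₀} (b : Ext k m m') (ρ : Raws m (len γ)) →
                 EqTm a (var (flex a i)) (t₀ [ wkE a ]) b ρ → SolveVar k i t₀ b ρ
    weakened⁻¹ {i = i} {t₀} b ρ u = cancelR (split-wkE b) _ _
      (trans (sym (lookup-liftE-flex a b ρ i)) (trans u
        (trans (sym ([⊙] t₀ (wkE a) (liftE a b ρ)))
          (trans (cong (t₀ [_]) (wkE-liftE a b ρ)) ([⊙] t₀ ρ (wkE b))))))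

    private
      hit : ∀ y → View a y → ¬ IsRigid a y → Σ (Fin (len γ)) λ y' → lookup (wkE a) y' ≡ var y
      hit _ (isFlex j)  ne = j , lookup-wkE a j
      hit _ (isRigid j) ne = ⊥-elim (ne (j , refl))

    -- A term unifiable with a variable of γ cannot mention rigid variables, so it comes from γ.
    solveFlex : ∀ i {t A} → Tmᴿ ψ (var (flex a i)) A → Tmᴿ ψ t A →
                Unifier γ (EqTm a (var (flex a i)) t) →
                (var (flex a i) ≡ t) ⊎ MGU γ (EqTm a (var (flex a i)) t)
    solveFlex i {t} {A} hi ht (unifier {ρ = ρ} h b u)
      with Strengthening.strengthenTm {X = IsRigid a} (overWk o) (split-wkE a)
             (λ j → freeR-wkE a (var j)) (λ y ne _ → hit y (view a y) ne) t (tmᴿ-≡ A≡ ht) free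
      where
      A≡ : A ≡ vty γ i [ hom (overWk o) ]T
      A≡ = tmᴿ-det hi (tmᴿ-raw (lookup-wkE a i) (tmᴿ-[] (tmᴿ-var i) (overWk o)))
      free : FreeR (IsRigid a) t
      -- The unifier equates the image of `t` with a weakening of `lookup ρ i`, and a weakening
      -- contains no rigid variable.
      free = freeR-liftE⁻¹ a b ρ t (subst (FreeR (IsRigid b))
        (trans (sym (lookup-liftE-flex a b ρ i)) u) (freeR-wkE b (lookup ρ i)))
    ... | t₀ , ht₀ , refl with solveVar k i ht₀ (unifier h b (weakened⁻¹ {t₀ = t₀} b ρ u))
    ... | inj₁ refl = inj₁ (sym (lookup-wkE a i))
    ... | inj₂ M    = inj₂ (mapMGU {U = SolveVar k i t₀} (weakened {t₀ = t₀}) (weakened⁻¹ {t₀ = t₀}) M)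

    solveFlex' : ∀ i {t A} → Tmᴿ ψ (var (flex a i)) A → Tmᴿ ψ t A →
                 Unifier γ (EqTm a t (var (flex a i))) →
                 (t ≡ var (flex a i)) ⊎ MGU γ (EqTm a t (var (flex a i)))
    solveFlex' i {t} hi ht U
      with solveFlex i hi ht
             (mapUnifier {U = EqTm a t (var (flex a i))} {V = EqTm a (var (flex a i)) t} (λ _ _ → sym) U)
    ... | inj₁ e = inj₁ (sym e)
    ... | inj₂ M = inj₂ (mapMGU {U = EqTm a (var (flex a i)) t} (λ _ _ → sym) (λ _ _ → sym) M)

  rigid≢gen : ∀ {k n n' m m'} (a : Ext k n n') (b : Ext k m m') ρ j {g l} (rs : Raws n' l) →
              ¬ var (rigid a j) [ liftE a b ρ ] ≡ gen g rs [ liftE a b ρ ]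
  rigid≢gen a b ρ j rs e = case trans (sym (lookup-liftE-rigid a b ρ j)) e of λ ()

  UnifyTm UnifyS : Ctx → Set
  UnifyTm γ = ∀ {ψ k} (o : Over γ ψ k) r r' {A} → Tmᴿ ψ r A → Tmᴿ ψ r' A →
              Unifier γ (EqTm (extOf o) r r') → (r ≡ r') ⊎ MGU γ (EqTm (extOf o) r r')
  UnifyS γ = ∀ {ψ k} (o : Over γ ψ k) {δ l} (rs rs' : Raws (len ψ) l) →
             Subᴿ ψ δ rs → Subᴿ ψ δ rs' →
             Unifier γ (EqS (extOf o) rs rs') → (rs ≡ rs') ⊎ MGU γ (EqS (extOf o) rs rs')

  -- After unifying two tuples up to their last components, it remains to unify the latter, either
  -- unchanged, or over a strictly shorter context.
  module UnifyAt (γ : Ctx) (smaller : ∀ Ω → len Ω < len γ → UnifyTm Ω) where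
    mutual
      unifyTm : UnifyTm γ
      unifyTm o (var x) r' h h' U with view (extOf o) x
      ... | isFlex i  = solveFlex o i h h' U
      ... | isRigid j = unifyRigid o j r' h h' U
      unifyTm o r@(gen g rs) (var y) h h' U with view (extOf o) y
      ... | isFlex i  = solveFlex' o i h' h U
      ... | isRigid j = ⊥-elim (rigid≢gen (extOf o) (Unifier.b U) (Unifier.ρ U) j rs
                                          (sym (Unifier.unifies U)))
      unifyTm o (gen g rs) (gen g' rs') h h' U@(unifier hρ b u)
        -- Substitution leaves heads unchanged, so the unifier itself yields equal labels. Equal
        -- labels have equal signatures, hence both argument tuples are typed over the same context.
        with gen-injective u | genTm (tm-has h) | genTm (tm-has h')
      ... | refl , refl , e | mk t sg hs _ | mk t' sg' hs' _ with trans (sym sg) sg'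
      ... | refl with unifyS o rs rs' (ofS hs) (ofS hs') (unifier hρ b (≅-to-≡ e))
      ... | inj₁ refl = inj₁ refl
      ... | inj₂ M = inj₂ (mapMGU {U = EqS (extOf o) rs rs'} (λ _ _ → cong (gen g))
        (λ _ _ e → ≅-to-≡ (proj₂ (proj₂ (gen-injective e)))) M)
      unifyTm o (gen g rs) junk h (ofTm (has () _)) U
      unifyTm o junk r' (ofTm (has () _)) h' U

      unifyRigid : ∀ {ψ k} (o : Over γ ψ k) j r' → let a = extOf o in ∀ {A} →
                   Tmᴿ ψ (var (rigid a j)) A → Tmᴿ ψ r' A → Unifier γ (EqTm a (var (rigid a j)) r') →
                   (var (rigid a j) ≡ r') ⊎ MGU γ (EqTm a (var (rigid a j)) r')
      unifyRigid o j (var y) h h' U with view (extOf o) y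
      ... | isFlex i   = solveFlex' o i h' h U
      ... | isRigid j' = inj₁ (cong (λ j → var (rigid (extOf o) j)) (rigid-injective (Unifier.b U)
        (var-injective (trans (sym (lookup-liftE-rigid (extOf o) (Unifier.b U) (Unifier.ρ U) j))
          (trans (Unifier.unifies U)
                 (lookup-liftE-rigid (extOf o) (Unifier.b U) (Unifier.ρ U) j'))))))
      unifyRigid o j (gen g rs) h h' U =
        ⊥-elim (rigid≢gen (extOf o) (Unifier.b U) (Unifier.ρ U) j rs (Unifier.unifies U))
      unifyRigid o j junk h (ofTm (has () _)) U

      unifyS : UnifyS γ
      unifyS o []       []         h h' U = inj₁ refl
      unifyS o {∙}     (rs ▸ r) (rs' ▸ r') (ofS (has () _)) h' U
      unifyS o {δ ▷ A} (rs ▸ r) (rs' ▸ r') h h' U@(unifier hρ b u)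
        -- The prefixes come first because the last components are known to share a type only once
        -- the prefixes agree.
        with unifyS o rs rs' (tailᴿ h) (tailᴿ h') (unifier hρ b (proj₁ (▸-injective u)))
      ... | inj₁ refl = lastComponent
        where
        lastComponent : (rs ▸ r ≡ rs ▸ r') ⊎ MGU γ (EqS (extOf o) (rs ▸ r) (rs ▸ r'))
        lastComponent
          with unifyTm o r r' (headᴿ h)
                 (tmᴿ-≡ (cong (A [_]T) (hom-det (tailᴿ h') (tailᴿ h) refl)) (headᴿ h'))
                 (unifier hρ b (proj₂ (▸-injective u)))
        ... | inj₁ refl = inj₁ refl
        ... | inj₂ M = inj₂ (mapMGU {U = EqTm (extOf o) r r'} (λ b ρ → cong (rs ⊙ liftE (extOf o) b ρ ▸_))
          (λ _ _ e → proj₂ (▸-injective e)) M)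
      ... | inj₂ M = inj₂ composite
        where
        module M = MGU M
        open Transported (transport o M.h₀) renaming (over to o'; sub to hρ₀)
        a = extOf o
        c = extOf o'
        composite : MGU γ (EqS a (rs ▸ r) (rs' ▸ r'))
        -- The given unifier factors through `M` as `τ`, which unifies the residual last components.
        -- Those may have grown under `M.ρ₀`; the recursive call is justified by the shorter context
        -- instead.
        composite with M.factor hρ b (proj₁ (▸-injective u))
        ... | τ , hτ , refl
          with smaller M.Ω M.shorter o' (r [ liftE a c M.ρ₀ ]) (r' [ liftE a c M.ρ₀ ])
                 (tmᴿ-[] (headᴿ h) hρ₀)
                 (tmᴿ-≡ (trans (hom-⊙ (tailᴿ h') hρ₀ (subᴿ-⊙ (tailᴿ h) hρ₀) (sym (M.unifies c)) A)
                               (sym (hom-⊙ (tailᴿ h) hρ₀ (subᴿ-⊙ (tailᴿ h) hρ₀) refl A)))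
                        (tmᴿ-[] (headᴿ h') hρ₀))
                 (unifier hτ b (trans (pushed r) (trans (proj₂ (▸-injective u)) (sym (pushed r')))))
          where
          pushed : ∀ x → x [ liftE a c M.ρ₀ ] [ liftE c b τ ] ≡ x [ liftE a b (M.ρ₀ ⊙ τ) ]
          pushed x = trans (sym ([⊙] x _ _)) (cong (x [_]) (liftE-⊙ a c b M.ρ₀ τ))
        ... | inj₂ N = composeMGU a {r = r} {r'} M c N
        ... | inj₁ e = record
          { shorter = M.shorter ; h₀ = M.h₀ ; monic = M.monic
          ; unifies = λ b' → cong₂ _▸_ (M.unifies b') (unifies b')
          ; factor = λ h b u → M.factor h b (proj₁ (▸-injective u)) }
          where
          unifies : ∀ {m'} (b' : Ext _ _ m') → r [ liftE a b' M.ρ₀ ] ≡ r' [ liftE a b' M.ρ₀ ]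
          unifies b' with ext-unique b' c
          ... | refl = e

  -- The bound `n` turns the descent to shorter contexts into structural recursion.
  unifyTm≤ : ∀ n γ → len γ ≤ n → UnifyTm γ
  unifyTm≤ n γ le = UnifyAt.unifyTm γ (smaller n le)
    where
    smaller : ∀ n → len γ ≤ n → ∀ Ω → len Ω < len γ → UnifyTm Ω
    smaller zero    le Ω lt = case ≤-trans lt le of λ ()
    smaller (suc n) le Ω lt with ≤-trans lt le
    ... | s≤s le' = unifyTm≤ n Ω le'

  unifyTm : ∀ γ → UnifyTm γ
  unifyTm γ = unifyTm≤ (len γ) γ ≤-refl

  unifyS : ∀ γ → UnifyS γ
  unifyS γ = UnifyAt.unifyS γ λ Ω _ → unifyTm Ω

  -- A type is never a variable, so the problem reduces at once to the argument tuples.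
  unifyTy : ∀ {γ ψ k} (o : Over γ ψ k) r r' {A A'} → HasTy ψ r A → HasTy ψ r' A' →
            Unifier γ (EqTm (extOf o) r r') → (r ≡ r') ⊎ MGU γ (EqTm (extOf o) r r')
  unifyTy {γ} o (gen g rs) (gen g' rs') h h' (unifier hρ b u)
    with gen-injective u | genTy h | genTy h'
  ... | refl , refl , e | mk T sg hs _ | mk T' sg' hs' _ with trans (sym sg) sg'
  ... | refl with unifyS γ o rs rs' (ofS hs) (ofS hs') (unifier hρ b (≅-to-≡ e))
  ... | inj₁ refl = inj₁ refl
  ... | inj₂ M = inj₂ (mapMGU {U = EqS (extOf o) rs rs'} (λ _ _ → cong (gen g))
    (λ _ _ e → ≅-to-≡ (proj₂ (proj₂ (gen-injective e)))) M)

-- Translation between telescopes of `C` and unification problems.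

module Telescopes (C : CwF) (cellular : IsICellular C) where
  open CwF C
  open Representation C cellular
  open RawFacts Label
  open Solving C cellular
  open Unification C cellular

  _++_ : ∀ γ → Tele C ⟦ γ ⟧ → Ctx
  γ ++ []      = γ
  γ ++ (A ∷ Δ) = (γ ▷ A) ++ Δ

  ⟦++⟧ : ∀ γ Δ → ⟦ γ ++ Δ ⟧ ≡ _⊳_ C ⟦ γ ⟧ Δ
  ⟦++⟧ γ []      = refl
  ⟦++⟧ γ (A ∷ Δ) = ⟦++⟧ (γ ▷ A) Δ

  over-++ : ∀ γ Δ → Over γ (γ ++ Δ) (tlen C Δ)
  over-++ γ []      = here
  over-++ γ (A ∷ Δ) = there (over-++ (γ ▷ A) Δ)

  ext-++ : ∀ {γ} θ (ρ : Hom ⟦ θ ⟧ ⟦ γ ⟧) Δ → Ext (tlen C Δ) (len θ) (len (θ ++ _[_]Tel C Δ ρ))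
  ext-++ θ ρ []      = done
  ext-++ {γ} θ ρ (A ∷ Δ) = step (ext-++ {γ ▷ A} (θ ▷ A [ ρ ]T) (lift C ρ A) Δ)

  -- A copy of `_⁺` between denotations of contexts, which is what `rawS` requires. The objects
  -- involved match those of `_⁺` only propositionally.
  plus : ∀ γ θ (ρ : Hom ⟦ θ ⟧ ⟦ γ ⟧) Δ → Hom ⟦ θ ++ _[_]Tel C Δ ρ ⟧ ⟦ γ ++ Δ ⟧
  plus γ θ ρ []      = ρ
  plus γ θ ρ (A ∷ Δ) = plus (γ ▷ A) (θ ▷ A [ ρ ]T) (lift C ρ A) Δ

  plus≡⁺ : ∀ γ θ (ρ : Hom ⟦ θ ⟧ ⟦ γ ⟧) Δ →
           subst₂ Hom (⟦++⟧ θ (_[_]Tel C Δ ρ)) (⟦++⟧ γ Δ) (plus γ θ ρ Δ) ≡ (C ⁺) ρ {Δ}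
  plus≡⁺ γ θ ρ []      = refl
  plus≡⁺ γ θ ρ (A ∷ Δ) = plus≡⁺ (γ ▷ A) (θ ▷ A [ ρ ]T) (lift C ρ A) Δ

  rawS-lift : ∀ γ θ (ρ : Hom ⟦ θ ⟧ ⟦ γ ⟧) A →
              rawS {θ ▷ A [ ρ ]T} {γ ▷ A} (lift C ρ A) ≡ liftR (rawS {θ} {γ} ρ)
  rawS-lift γ θ ρ A = sym (rawS-unique {θ ▷ A [ ρ ]T} {γ ▷ A} _ (hasS-▸
    (hasS-≡ (sym (p∘⟨⟩ _ _)) (hasS-∘ (rawS-has {θ} {γ} ρ) (hasS-wk {θ} {A [ ρ ]T})))
    (has tt (sym (trans (qq-ext (ρ ∘ p) (A [ ρ ∘ p ]T , _) refl)
                        (pair≡ ([∘]T A ρ p) (≡-subst-removable (Tm _) _ q)))))))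

  rawS-plus : ∀ γ θ (ρ : Hom ⟦ θ ⟧ ⟦ γ ⟧) Δ →
              rawS {θ ++ _[_]Tel C Δ ρ} {γ ++ Δ} (plus γ θ ρ Δ) ≡
              liftE (extOf (over-++ γ Δ)) (ext-++ {γ} θ ρ Δ) (rawS {θ} {γ} ρ)
  rawS-plus γ θ ρ []      = refl
  rawS-plus γ θ ρ (A ∷ Δ) = trans (rawS-plus (γ ▷ A) (θ ▷ A [ ρ ]T) (lift C ρ A) Δ)
    (cong (liftE (extOf (over-++ (γ ▷ A) Δ)) (ext-++ {γ ▷ A} (θ ▷ A [ ρ ]T) (lift C ρ A) Δ))
          (rawS-lift γ θ ρ A))

  teleOf : ∀ γ (Δ : Tele C ⟦ γ ⟧) →
           Σ (Tele C ◇) λ Δ' → (_⊳_ C ◇ Δ' ≡ _⊳_ C ⟦ γ ⟧ Δ) × (tlen C Δ' ≡ len γ + tlen C Δ)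
  teleOf ∙       Δ = Δ , refl , refl
  teleOf (γ ▷ A) Δ with teleOf γ (A ∷ Δ)
  ... | Δ' , e , e' = Δ' , e , trans e' (+-suc (len γ) (tlen C Δ))

  hasLength : ∀ γ → HasLength C ⟦ γ ⟧ (len γ)
  hasLength γ with teleOf γ []
  ... | Δ , e , e' = Δ , e , trans e' (+-identityʳ (len γ))

  -- Packing a tuple together with its base morphism reduces tuples of dependent terms to morphisms,
  -- hence to `unifyS`.
  homOf : ∀ {Ψ} φ {σ : Hom Ψ ⟦ φ ⟧} Ξ → TmS C Ψ σ Ξ → Hom Ψ ⟦ φ ++ Ξ ⟧
  homOf φ {σ} []      bs       = σ
  homOf φ     (B ∷ Ξ) (b , bs) = homOf (φ ▷ B) Ξ bs

  homOf-subst : ∀ {Ψ} φ {σ σ' : Hom Ψ ⟦ φ ⟧} (e : σ ≡ σ') Ξ (bs : TmS C Ψ σ Ξ) →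
                homOf φ Ξ (subst (λ s → TmS C Ψ s Ξ) e bs) ≡ homOf φ Ξ bs
  homOf-subst φ refl Ξ bs = refl

  homOf-subS : ∀ {Ψ Ψ'} φ {σ : Hom Ψ ⟦ φ ⟧} Ξ (bs : TmS C Ψ σ Ξ) (τ : Hom Ψ' Ψ) →
               homOf φ Ξ (subS C Ξ bs τ) ≡ homOf φ Ξ bs ∘ τ
  homOf-subS φ []      bs       τ = refl
  homOf-subS φ {σ} (B ∷ Ξ) (b , bs) τ =
    trans (homOf-subst (φ ▷ B) (⟨⟩∘ σ b τ) Ξ (subS C Ξ bs τ)) (homOf-subS (φ ▷ B) Ξ bs τ)

  homOf-injective : ∀ {Ψ} φ {σ σ' : Hom Ψ ⟦ φ ⟧} Ξ (bs : TmS C Ψ σ Ξ) (bs' : TmS C Ψ σ' Ξ) →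
                    homOf φ Ξ bs ≡ homOf φ Ξ bs' → σ ≡ σ' × bs ≅ bs'
  homOf-injective φ []      bs       bs'        e = e , refl
  homOf-injective φ {σ} {σ'} (B ∷ Ξ) (b , bs) (b' , bs') e
    with homOf-injective (φ ▷ B) Ξ bs bs' e
  ... | e₁ , e₂ = σ≡ , aux σ≡ b≅ e₁ e₂
    where
    σ≡ : σ ≡ σ'
    σ≡ = trans (sym (p∘⟨⟩ σ b)) (trans (cong (p ∘_) e₁) (p∘⟨⟩ σ' b'))
    b≅ : b ≅ b'
    b≅ = Het.trans (Het.sym (q[⟨⟩] σ b)) (Het.trans (Het.cong (λ x → q [ x ]t) (≡-to-≅ e₁)) (q[⟨⟩] σ' b'))
    aux : ∀ {σ σ'} {b : Tm _ (B [ σ ]T)} {b' : Tm _ (B [ σ' ]T)}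
          {bs : TmS C _ ⟨ σ , b ⟩ Ξ} {bs' : TmS C _ ⟨ σ' , b' ⟩ Ξ} →
          σ ≡ σ' → b ≅ b' → ⟨ σ , b ⟩ ≡ ⟨ σ' , b' ⟩ → bs ≅ bs' →
          _≅_ {A = TmS C _ σ (B ∷ Ξ)} (b , bs) {B = TmS C _ σ' (B ∷ Ξ)} (b' , bs')
    aux refl refl _ refl = refl

  rawTm-inj : ∀ {γ} {s s' : TTm ⟦ γ ⟧} → rawTm {γ} s ≡ rawTm {γ} s' → s ≡ s'
  rawTm-inj {γ} {s} {s'} e =
    hasTm-det (rawTm-has s) (subst (λ r → HasTm γ r s') (sym e) (rawTm-has s'))

  rawS-inj : ∀ {γ δ} {σ σ' : Hom ⟦ γ ⟧ ⟦ δ ⟧} → rawS {γ} {δ} σ ≡ rawS {γ} {δ} σ' → σ ≡ σ'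
  rawS-inj {γ} {δ} {σ} {σ'} e =
    hasS-det (rawS-has σ) (subst (λ r → HasS γ δ r σ') (sym e) (rawS-has σ'))

  -- A common interface to the three kinds of parallel elements, with `T` the syntactic equality of
  -- their raw forms. The object carrying `x` equals the denotation of `ψ` only propositionally;
  -- with `e` and `e'` general, both can be matched with `refl`.
  record Reified {γ ψ k} (o : Over γ ψ k) {Ψ} (e : ⟦ ψ ⟧ ≡ Ψ) (x : Parallel C Ψ) : Set₁ where
    field
      U     : Problem k (len γ)
      T     : Set
      T⇒U   : T → ∀ {m m'} (b : Ext k m m') ρ → U b ρ
      solve : Unifier γ U → T ⊎ MGU γ U
      sound : ∀ {ψ' Ψ' m} (e' : ⟦ ψ' ⟧ ≡ Ψ') (τ : Hom ⟦ ψ' ⟧ ⟦ ψ ⟧) (b : Ext k m (len ψ')) ρ →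
              rawS {ψ'} {ψ} τ ≡ liftE (extOf o) b ρ → U b ρ → EqualizedBy C x (subst₂ Hom e' e τ)
      complete : ∀ {ψ' Ψ' m} (e' : ⟦ ψ' ⟧ ≡ Ψ') (τ : Hom ⟦ ψ' ⟧ ⟦ ψ ⟧) (b : Ext k m (len ψ')) ρ →
                 rawS {ψ'} {ψ} τ ≡ liftE (extOf o) b ρ → EqualizedBy C x (subst₂ Hom e' e τ) → U b ρ

  reify : ∀ {γ ψ k} (o : Over γ ψ k) {Ψ} (e : ⟦ ψ ⟧ ≡ Ψ) (x : Parallel C Ψ) → Reified o e x
  reify {γ} {ψ} o refl (ty-pair A A') = record
    { U = EqTm (extOf o) r r' ; T = r ≡ r' ; T⇒U = λ e b ρ → cong (_[ liftE (extOf o) b ρ ]) e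
    ; solve = unifyTy o r r' (rawTy-has A) (rawTy-has A')
    ; sound = λ { {ψ'} refl τ b ρ e u → rawTy-inj {ψ'} (trans (rawTy-[] {ψ} {ψ'} A τ)
        (trans (cong (r [_]) e) (trans u (sym (trans (rawTy-[] {ψ} {ψ'} A' τ) (cong (r' [_]) e)))))) }
    ; complete = λ { {ψ'} refl τ b ρ e u →
        trans (sym (trans (rawTy-[] {ψ} {ψ'} A τ) (cong (r [_]) e)))
          (trans (cong (rawTy {ψ'}) u) (trans (rawTy-[] {ψ} {ψ'} A' τ) (cong (r' [_]) e))) } }
    where
    r  = rawTy {ψ} A
    r' = rawTy {ψ} A'
  reify {γ} {ψ} o refl (tm-pair A t t') = record
    { U = EqTm (extOf o) r r' ; T = r ≡ r' ; T⇒U = λ e b ρ → cong (_[ liftE (extOf o) b ρ ]) e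
    ; solve = unifyTm γ o r r' (ofTm (rawTm-has (A , t))) (ofTm (rawTm-has (A , t')))
    ; sound = λ { {ψ'} refl τ b ρ e u → ≅-to-≡ (pair≅ (rawTm-inj {ψ'}
        (trans (rawTm-[] {ψ} {ψ'} (A , t) τ) (trans (cong (r [_]) e)
        (trans u (sym (trans (rawTm-[] {ψ} {ψ'} (A , t') τ) (cong (r' [_]) e)))))))) }
    ; complete = λ { {ψ'} refl τ b ρ e u →
        trans (sym (trans (rawTm-[] {ψ} {ψ'} (A , t) τ) (cong (r [_]) e)))
          (trans (cong (λ y → rawTm {ψ'} (A [ τ ]T , y)) u)
            (trans (rawTm-[] {ψ} {ψ'} (A , t') τ) (cong (r' [_]) e))) } }
    where
    r  = rawTm {ψ} (A , t)
    r' = rawTm {ψ} (A , t')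
  reify {γ} {ψ} o refl (tm⋆-pair Ξ bs bs') = record
    { U = EqS (extOf o) rs rs' ; T = rs ≡ rs' ; T⇒U = λ e b ρ → cong (_⊙ liftE (extOf o) b ρ) e
    ; solve = unifyS γ o rs rs' (ofS (rawS-has {ψ} {ψ ++ Ξ} σ)) (ofS (rawS-has {ψ} {ψ ++ Ξ} σ'))
    ; sound = λ { {ψ'} refl τ b ρ e u → ≅-to-≡ (proj₂ (homOf-injective ψ Ξ _ _
        (trans (homOf-subS ψ Ξ bs τ) (trans (rawS-inj {ψ'} {ψ ++ Ξ}
          (trans (rawS-∘ {ψ} {ψ ++ Ξ} {ψ'} σ τ) (trans (cong (rs ⊙_) e)
          (trans u (sym (trans (rawS-∘ {ψ} {ψ ++ Ξ} {ψ'} σ' τ) (cong (rs' ⊙_) e)))))))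
          (sym (homOf-subS ψ Ξ bs' τ)))))) }
    ; complete = λ { {ψ'} refl τ b ρ e u →
        trans (sym (trans (rawS-∘ {ψ} {ψ ++ Ξ} {ψ'} σ τ) (cong (rs ⊙_) e)))
          (trans (cong (rawS {ψ'} {ψ ++ Ξ})
            (trans (sym (homOf-subS ψ Ξ bs τ)) (trans (cong (homOf ψ Ξ) u) (homOf-subS ψ Ξ bs' τ))))
            (trans (rawS-∘ {ψ} {ψ ++ Ξ} {ψ'} σ' τ) (cong (rs' ⊙_) e))) } }
    where
    σ   = homOf ψ Ξ bs
    σ'  = homOf ψ Ξ bs'
    rs  = rawS {ψ} {ψ ++ Ξ} σ
    rs' = rawS {ψ} {ψ ++ Ξ} σ'

  module _ (γ : Ctx) (Δ : Tele C ⟦ γ ⟧) (x : Parallel C (_⊳_ C ⟦ γ ⟧ Δ)) where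
    private
      module R = Reified (reify (over-++ γ Δ) (⟦++⟧ γ Δ) x)

    unifier-sound : ∀ θ (ρ : Hom ⟦ θ ⟧ ⟦ γ ⟧) → R.U (ext-++ {γ} θ ρ Δ) (rawS {θ} {γ} ρ) →
                    IsUnifier C Δ x ρ
    unifier-sound θ ρ u = subst (EqualizedBy C x) (plus≡⁺ γ θ ρ Δ)
      (R.sound (⟦++⟧ θ (_[_]Tel C Δ ρ)) (plus γ θ ρ Δ) _ _ (rawS-plus γ θ ρ Δ) u)

    unifier-complete : ∀ θ (ρ : Hom ⟦ θ ⟧ ⟦ γ ⟧) → IsUnifier C Δ x ρ →
                       R.U (ext-++ {γ} θ ρ Δ) (rawS {θ} {γ} ρ)
    unifier-complete θ ρ u = R.complete (⟦++⟧ θ (_[_]Tel C Δ ρ)) (plus γ θ ρ Δ) _ _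
      (rawS-plus γ θ ρ Δ) (subst (EqualizedBy C x) (sym (plus≡⁺ γ θ ρ Δ)) u)

    identity-mgu : R.T → IsMGU C Δ x id
    identity-mgu t = unifier-sound γ id (R.T⇒U t _ _) ,
      λ ρ _ → ρ , sym (idl ρ) , λ τ e → trans (sym (idl τ)) (sym e)

    module _ (M : MGU γ R.U) where
      private
        module M = MGU M
        raw-h₀ : rawS {M.Ω} {γ} (hom M.h₀) ≡ M.ρ₀
        raw-h₀ = sym (rawS-unique {M.Ω} {γ} M.ρ₀ (hom-has M.h₀))

      mgu : IsMGU C Δ x (hom M.h₀)
      mgu = unifier-sound M.Ω (hom M.h₀) (subst (R.U _) (sym raw-h₀) (M.unifies _)) , factor
        where
        factor : ∀ {Θ} (ρ : Hom Θ ⟦ γ ⟧) → IsUnifier C Δ x ρ →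
                 Σ (Hom Θ ⟦ M.Ω ⟧) λ τ → (ρ ≡ hom M.h₀ ∘ τ) ×
                   ((τ' : Hom Θ ⟦ M.Ω ⟧) → ρ ≡ hom M.h₀ ∘ τ' → τ' ≡ τ)
        factor {Θ} ρ u with ctxOf Θ
        ... | θ , refl with M.factor (ofS (rawS-has {θ} {γ} ρ)) _ (unifier-complete θ ρ u)
        ... | τ , hτ , e = hom hτ ,
          hom-det (ofS (rawS-has {θ} {γ} ρ)) (subᴿ-⊙ M.h₀ hτ) e ,
          λ τ' e' → hom-det (ofS (rawS-has {θ} {M.Ω} τ')) hτ (M.monic _ _
            (trans (cong (_⊙ rawS {θ} {M.Ω} τ') (sym raw-h₀))
              (trans (sym (rawS-∘ {M.Ω} {γ} {θ} (hom M.h₀) τ'))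
                (trans (cong (rawS {θ} {γ}) (sym e')) e))))

    most-general : ∀ θ (σ : Hom ⟦ θ ⟧ ⟦ γ ⟧) → IsUnifier C Δ x σ →
      Σ Ob λ Ω → Σ (Hom Ω ⟦ γ ⟧) λ ρ → IsMGU C Δ x ρ ×
        (Σ (Ω ≡ ⟦ γ ⟧) (λ _ → ρ ≅ id {⟦ γ ⟧}) ⊎
         Σ ℕ λ m → Σ ℕ λ n → HasLength C Ω m × HasLength C ⟦ γ ⟧ n × m < n)
    most-general θ σ u
      with R.solve (unifier (ofS (rawS-has {θ} {γ} σ)) _ (unifier-complete θ σ u))
    ... | inj₁ t = ⟦ γ ⟧ , id , identity-mgu t , inj₁ (refl , refl)
    ... | inj₂ M = ⟦ MGU.Ω M ⟧ , hom (MGU.h₀ M) , mgu M ,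
      inj₂ (_ , _ , hasLength (MGU.Ω M) , hasLength γ , MGU.shorter M)

theorem30 : (C : CwF) → IsICellular C →
    (Γ : CwF.Ob C) (Δ : Tele C Γ) (x : Parallel C (_⊳_ C Γ Δ)) →
    Σ (CwF.Ob C) (λ Θ → Σ (CwF.Hom C Θ Γ) (λ σ → IsUnifier C Δ x σ)) →
    Σ (CwF.Ob C) (λ Ω → Σ (CwF.Hom C Ω Γ) (λ ρ →
    IsMGU C Δ x ρ ×
    (Σ (Ω ≡ Γ) (λ _ → ρ ≅ CwF.id C {Γ}) ⊎
    Σ ℕ (λ m → Σ ℕ (λ n → HasLength C Ω m × HasLength C Γ n × m < n)))))
theorem30 C cellular Γ Δ x (Θ , σ , u)
  with Representation.ctxOf C cellular Γ | Representation.ctxOf C cellular Θ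
... | γ , refl | θ , refl = Telescopes.most-general C cellular γ Δ x θ σ u
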